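{- Let $n$ be a positive integer and let $\Omega_1,\Omega_2$ be two distinct copies of $2^{[n]}$, where $[n]=\{1,\dots,n\}$. For $i=1,2$ let $\bm{p}_i=(p_i^{(1)},\dots,p_i^{(n)})$ be a probability vector (i.e. $0<p_i^{(\ell)}<1$ for all $\ell$), write $p_i:=p_i^{(1)}$, and let $\mu_i$ be the product measure on $\Omega_i$ given by $$\mu_i(U)=\sum_{x\in U}\prod_{\ell\in x}p_i^{(\ell)}\prod_{k\in[n]\setminus x}(1-p_i^{(k)})\qquad (U\subset\Omega_i).$$ Assume that $p_i=\max\{p_i^{(\ell)}:\ell\in[n]\}$ for $i=1,2$, and that $p_1^{(\ell)},p_2^{(\ell)}\leqslant 1/2$ for all $\ell\geqslant 2$. If $U_1\subset\Omega_1$ and $U_2\subset\Omega_2$ are cross-intersecting (i.e. $x\cap y\neq\emptyset$ for all $x\in U_1$, $y\in U_2$), then $$\mu_1(U_1)\mu_2(U_2)\leqslant p_1p_2.$$ Moreover, let $w:=\{\ell\in[n]:(p_1^{(\ell)},p_2^{(\ell)})=(p_1,p_2)\}$ and, for $i=1,2$ and $\ell\in[n]$, let $U_i^{(\ell)}:=\{x\in\Omega_i:\ell\in x\}$. Unless $p_1=p_2=1/2$ and $|w|\geqslant 3$, equality holds if and only if $U_1=U_1^{(\ell)}$ and $U_2=U_2^{(\ell)}$ for some $\ell\in w$.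
   Context: A probability vector is a vector $\bm{p}=(p^{(1)},\dots,p^{(n)})$ with $0<p^{(\ell)}<1$ for every $\ell$. -}

module Defs where

open import Level using (Level; _⊔_) renaming (suc to lsuc)
open import Data.Nat.Base as ℕ using (ℕ; zero; suc)
open import Data.Fin.Base using (Fin)
open import Data.Fin.Subset using (Subset; inside; outside; _∈_; _∩_; ∁; Nonempty)
open import Data.Fin.Subset.Properties using (_∈?_)
open import Data.List.Base using (List; []; _∷_; _++_; map; foldr; filter; allFin)
open import Data.Vec.Base as Vec using ()
open import Data.Vec.Functional using (Vector)
open import Data.Product.Base using (_×_; _,_; proj₁; ∃; ∃-syntax)
open import Data.Sum.Base using (_⊎_)
open import Function.Bundles using (_↣_; Injection)
open import Relation.Nullary.Negation using (¬_)
open import Relation.Unary using (Pred; Decidable)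
open import Relation.Binary.Core using (Rel)
open import Relation.Binary.Structures using (IsStrictPartialOrder)
open import Algebra.Apartness.Bundles using (HeytingField; HeytingCommutativeRing)
open import Algebra.Bundles using (CommutativeRing)
import Algebra.Definitions.RawMonoid as RawMonoidDefs

-- ℝ is given axiomatically, as a Cauchy complete Archimedean ordered field.
-- The axioms are those of the constructive reals; classically they determine ℝ
-- up to isomorphism.  No decidability of _<_ or _≈_ is assumed.
record RealNumbers c ℓ₁ ℓ₂ : Set (lsuc (c ⊔ ℓ₁ ⊔ ℓ₂)) where
  infix 4 _<_ _≤_
  field
    heytingField : HeytingField c ℓ₁ ℓ₂

  open HeytingField heytingField public renaming (zero to *-zero)
  open HeytingCommutativeRing heytingCommutativeRing public using (commutativeRing)
  open CommutativeRing commutativeRing public using (+-rawMonoid)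
  open RawMonoidDefs +-rawMonoid public using () renaming (_×_ to _·_)

  field
    _<_                  : Rel Carrier ℓ₂
    isStrictPartialOrder : IsStrictPartialOrder _≈_ _<_
    <⇒#                  : ∀ {x y} → x < y → x # y
    #⇒<⊎>                : ∀ {x y} → x # y → x < y ⊎ y < x
    0<1                  : 0# < 1#
    +-monoˡ-<            : ∀ z {x y} → x < y → x + z < y + z
    *-pos                : ∀ {x y} → 0# < x → 0# < y → 0# < x * y

  _≤_ : Rel Carrier ℓ₂
  x ≤ y = ¬ (y < x)

  IsCauchy : (ℕ → Carrier) → Set (c ⊔ ℓ₂)
  IsCauchy s = ∀ {ε} → 0# < ε →
    ∃[ N ] (∀ {m n} → N ℕ.≤ m → N ℕ.≤ n → s m < s n + ε)

  _ConvergesTo_ : (ℕ → Carrier) → Carrier → Set (c ⊔ ℓ₂)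
  s ConvergesTo L = ∀ {ε} → 0# < ε →
    ∃[ N ] (∀ {n} → N ℕ.≤ n → s n < L + ε × L < s n + ε)

  field
    archimedean : ∀ x → ∃[ n ] x < n · 1#
    complete    : ∀ s → IsCauchy s → ∃[ L ] s ConvergesTo L

  open IsStrictPartialOrder isStrictPartialOrder public
    using (<-respˡ-≈; <-respʳ-≈)
    renaming (irrefl to <-irrefl; trans to <-trans; asym to <-asym)

  0<2 : 0# < 1# + 1#
  0<2 = <-trans 0<1 (<-respˡ-≈ (+-identityˡ 1#) (+-monoˡ-< 1# 0<1))

  ½ : Carrier
  ½ = proj₁ (#⇒invertible (#-sym (<⇒# 0<2)))

subsets : ∀ n → List (Subset n)
subsets zero    = Vec.[] ∷ []
subsets (suc n) = map (inside Vec.∷_) (subsets n) ++ map (outside Vec.∷_) (subsets n)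

CrossIntersecting : ∀ {n u₁ u₂} → Pred (Subset n) u₁ → Pred (Subset n) u₂ → Set (u₁ ⊔ u₂)
CrossIntersecting U₁ U₂ = ∀ {x y} → U₁ x → U₂ y → Nonempty (x ∩ y)

Star : ∀ {n} → Fin n → Pred (Subset n) _
Star ℓ x = ℓ ∈ x

-- The (possibly undecidable) set A has cardinality at least k.
HasAtLeast : ∀ {n a} → ℕ → Pred (Fin n) a → Set a
HasAtLeast {n} k A = ∃ λ (f : Fin k ↣ Fin n) → ∀ i → A (Injection.to f i)

module ProductMeasure {c ℓ₁ ℓ₂} (R : RealNumbers c ℓ₁ ℓ₂) where
  open RealNumbers R

  IsProbabilityVector : ∀ {n} → Vector Carrier n → Set ℓ₂
  IsProbabilityVector p = ∀ ℓ → 0# < p ℓ × p ℓ < 1#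

  _IsMaxOf_ : ∀ {n} → Carrier → Vector Carrier n → Set (ℓ₁ ⊔ ℓ₂)
  m IsMaxOf p = (∃[ ℓ ] m ≈ p ℓ) × (∀ ℓ → p ℓ ≤ m)

  ∑ : List Carrier → Carrier
  ∑ = foldr _+_ 0#

  ∏ : List Carrier → Carrier
  ∏ = foldr _*_ 1#

  ∏[_] : ∀ {n} → Subset n → Vector Carrier n → Carrier
  ∏[_] {n} x f = ∏ (map f (filter (_∈? x) (allFin n)))

  weight : ∀ {n} → Vector Carrier n → Subset n → Carrier
  weight p x = ∏[ x ] p * ∏[ ∁ x ] (λ k → 1# - p k)

  μ : ∀ {n u} → Vector Carrier n → {U : Pred (Subset n) u} → Decidable U → Carrier
  μ {n} p U? = ∑ (map (weight p) (filter U? (subsets n)))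

  -- Fin.zero plays the role of the coordinate 1 ∈ [n].
  w : ∀ {m} → Vector Carrier (suc m) → Vector Carrier (suc m) → Pred (Fin (suc m)) ℓ₁
  w p₁ p₂ ℓ = p₁ ℓ ≈ p₁ Fin.zero × p₂ ℓ ≈ p₂ Fin.zero

module Submission where

-- Write q = 1 - p, and first assume p₁, p₂ ≤ ½.  By induction on the number of coordinates, the measures
-- (a , b) of cross-intersecting families satisfy both
--   a b ≤ p₁ p₂   and   q₁ q₂ a b ≤ p₁ p₂ (1 - a) (1 - b).
-- Splitting along a coordinate gives families of measures a₁ (union of both sections), a₀ (the section
-- without the coordinate), and likewise b₁, b₀; the constraints on (a₁ , b₀) and (a₀ , b₁) imply those on
-- (p₁ a₁ + q₁ a₀ , p₂ b₁ + q₂ b₀).  The second constraint is the spectral bound and is needed only when a₀ / a₁ and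
-- b₀ / b₁ are both below κ = p₁ p₂ / (q₁ q₂); otherwise the first one reproduces itself.  For κ < 1,
-- equality forces a₁ = a₀ and b₁ = b₀ (the coordinate is irrelevant) or a₁ = b₁ = 1 and a₀ = b₀ = 0 (a star).
-- For κ = 1 equality means a + b = 1, and coordinates below (½ , ½) are irrelevant, so at most two matter.
-- A first coordinate with p₁ > ½ is lowered to ½: μ₁ (U₁) / p₁ is nonincreasing in p₁, and it is
-- unchanged only if every member of U₁ contains the first coordinate.
-- Since _≤_ is a negation and _≈_ is stable, case distinctions on reals are made under double negation.

open import Defs
open import Algebra.Bundles using (CommutativeRing)
import Algebra.Properties.AbelianGroup
import Algebra.Properties.Ring
import Algebra.Properties.Semiring.Mult.TCOptimised
import Algebra.Solver.Ring
open import Algebra.Solver.Ring.AlmostCommutativeRing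
  using (fromCommutativeRing; _-Raw-AlmostCommutative⟶_)
open import Data.Bool.Base using (Bool; true; false; _∨_; if_then_else_)
import Data.Bool.Properties as Bool
open import Data.Fin.Base using (Fin; zero; suc)
open import Data.Fin.Properties using (any?; suc-injective)
open import Data.Fin.Subset using (Subset; inside; outside; Nonempty; _∈_; _∩_; ∁; ⊥; ⁅_⁆)
open import Data.Fin.Subset.Properties using (_∈?_; ∩-comm; ∉⊥; p∩q⊆p; x∈⁅x⁆; x∈⁅y⁆⇒x≡y)
open import Data.Integer.Base as ℤ using (ℤ; +_; -[1+_])
import Data.Integer.Properties as ℤ
open import Data.List.Base as List using (List; map; filter; allFin; _++_)
open import Data.List.Properties using (map-tabulate)
open import Data.Maybe.Base using (Maybe; just; nothing)
open import Data.Nat.Base as ℕ using (ℕ; zero; suc)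
import Data.Nat.Properties as ℕ
open import Data.Product.Base using (_×_; _,_; proj₁; proj₂; ∃-syntax)
open import Data.Sum.Base using (_⊎_; inj₁; inj₂; [_,_]′)
open import Data.Vec.Base using ([]; _∷_; lookup; there)
open import Data.Vec.Functional using (Vector) renaming (_∷_ to _∷ᵛ_)
open import Data.Vec.Properties using ([]=⇒lookup; lookup⇒[]=; lookup-replicate)
open import Function.Base using (_∘_; const; id)
open import Function.Bundles using (_⇔_; mk⇔; mk↣; Injection)
open import Level using (_⊔_)
open import Relation.Binary.PropositionalEquality as ≡ using (_≡_; _≗_)
open import Relation.Nullary.Decidable using (Dec; yes; no; does; dec-true; decidable-stable)
open import Relation.Nullary.Negation using (¬_; contradiction)
open import Relation.Unary using (Pred; Decidable; _≐_)

private variable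
  n : ℕ

-- A ring solver for the reals with integer coefficients.

module IntegerCoefficientSolver {c ℓ} (R : CommutativeRing c ℓ) where
  open CommutativeRing R
  open Algebra.Properties.Ring ring using (-‿distribˡ-*; -‿distribʳ-*; -0#≈0#; -‿involutive)
  open Algebra.Properties.AbelianGroup +-abelianGroup using (⁻¹-∙-comm)
  open Algebra.Properties.Semiring.Mult.TCOptimised semiring
    using (×-homo-+; ×1-homo-*; 1+×) renaming (_×_ to _·_)
  open import Relation.Binary.Reasoning.Setoid setoid

  -- Equality of reals is undecidable, so the solver takes its coefficients from the integers, where
  -- cancellations are found by computation. With this multiple operation `ι (+ 1)` is `1#` by
  -- definition, so `con (+ 1)` denotes `1#` itself.
  ι : ℤ → Carrier
  ι (+ n)    = n · 1#
  ι -[1+ n ] = - (suc n · 1#)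

  ι-neg : ∀ i → ι (ℤ.- i) ≈ - ι i
  ι-neg (+ zero)  = sym -0#≈0#
  ι-neg (+ suc n) = refl
  ι-neg -[1+ n ]  = sym (-‿involutive _)

  ι-⊖ : ∀ m n → ι (m ℤ.⊖ n) ≈ m · 1# - n · 1#
  ι-⊖ zero    zero    = sym (-‿inverseʳ 0#)
  ι-⊖ zero    (suc n) = sym (+-identityˡ _)
  ι-⊖ (suc m) zero    = sym (trans (+-congˡ -0#≈0#) (+-identityʳ _))
  ι-⊖ (suc m) (suc n) = begin
    ι (suc m ℤ.⊖ suc n)                    ≡⟨ ≡.cong ι (ℤ.[1+m]⊖[1+n]≡m⊖n m n) ⟩
    ι (m ℤ.⊖ n)                            ≈⟨ ι-⊖ m n ⟩
    m · 1# - n · 1#                        ≈⟨ +-congʳ (+-identityˡ _) ⟨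
    0# + m · 1# - n · 1#                   ≈⟨ +-congʳ (+-congʳ (-‿inverseʳ 1#)) ⟨
    (1# - 1#) + m · 1# - n · 1#            ≈⟨ +-congʳ (+-assoc _ _ _) ⟩
    1# + (- 1# + m · 1#) - n · 1#          ≈⟨ +-congʳ (+-congˡ (+-comm _ _)) ⟩
    1# + (m · 1# - 1#) - n · 1#            ≈⟨ +-congʳ (+-assoc _ _ _) ⟨
    1# + m · 1# - 1# - n · 1#              ≈⟨ +-assoc _ _ _ ⟩
    1# + m · 1# + (- 1# - n · 1#)          ≈⟨ +-cong (sym (1+× m 1#)) (⁻¹-∙-comm _ _) ⟩
    suc m · 1# - (1# + n · 1#)             ≈⟨ +-congˡ (-‿cong (1+× n 1#)) ⟨
    suc m · 1# - suc n · 1#                ∎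

  ι-+ : ∀ i j → ι (i ℤ.+ j) ≈ ι i + ι j
  ι-+ (+ m)    (+ n)    = ×-homo-+ 1# m n
  ι-+ (+ m)    -[1+ n ] = ι-⊖ m (suc n)
  ι-+ -[1+ m ] (+ n)    = trans (ι-⊖ n (suc m)) (+-comm _ _)
  ι-+ -[1+ m ] -[1+ n ] = begin
    - (suc (suc (m ℕ.+ n)) · 1#)       ≡⟨ ≡.cong (λ k → - (suc k · 1#)) (ℕ.+-suc m n) ⟨
    - ((suc m ℕ.+ suc n) · 1#)         ≈⟨ -‿cong (×-homo-+ 1# (suc m) (suc n)) ⟩
    - (suc m · 1# + suc n · 1#)        ≈⟨ ⁻¹-∙-comm _ _ ⟨
    - (suc m · 1#) - suc n · 1#        ∎

  ι-pos-* : ∀ m j → ι (+ m ℤ.* j) ≈ m · 1# * ι j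
  ι-pos-* m (+ n)    = begin
    ι (+ m ℤ.* + n)            ≡⟨ ≡.cong ι (ℤ.pos-* m n) ⟨
    (m ℕ.* n) · 1#             ≈⟨ ×1-homo-* m n ⟩
    m · 1# * (n · 1#)          ∎
  ι-pos-* m -[1+ n ] = begin
    ι (+ m ℤ.* -[1+ n ])       ≡⟨ ≡.cong ι (ℤ.neg-distribʳ-* (+ m) (+ suc n)) ⟨
    ι (ℤ.- (+ m ℤ.* + suc n))  ≈⟨ ι-neg (+ m ℤ.* + suc n) ⟩
    - ι (+ m ℤ.* + suc n)      ≈⟨ -‿cong (ι-pos-* m (+ suc n)) ⟩
    - (m · 1# * (suc n · 1#))  ≈⟨ -‿distribʳ-* _ _ ⟩
    m · 1# * - (suc n · 1#)    ∎

  ι-* : ∀ i j → ι (i ℤ.* j) ≈ ι i * ι j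
  ι-* (+ m)    j = ι-pos-* m j
  ι-* -[1+ m ] j = begin
    ι (-[1+ m ] ℤ.* j)         ≡⟨ ≡.cong ι (ℤ.neg-distribˡ-* (+ suc m) j) ⟨
    ι (ℤ.- (+ suc m ℤ.* j))    ≈⟨ ι-neg (+ suc m ℤ.* j) ⟩
    - ι (+ suc m ℤ.* j)        ≈⟨ -‿cong (ι-pos-* (suc m) j) ⟩
    - (suc m · 1# * ι j)       ≈⟨ -‿distribˡ-* _ _ ⟩
    - (suc m · 1#) * ι j       ∎

  morphism : ℤ.+-*-rawRing -Raw-AlmostCommutative⟶ fromCommutativeRing R
  morphism = record
    { ⟦_⟧    = ι
    ; +-homo = ι-+
    ; *-homo = ι-*
    ; -‿homo = ι-neg
    ; 0-homo = refl
    ; 1-homo = refl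
    }

  ι-≟ : ∀ i j → Maybe (ι i ≈ ι j)
  ι-≟ i j with i ℤ.≟ j
  ... | yes ≡.refl = just refl
  ... | no _       = nothing

  open Algebra.Solver.Ring ℤ.+-*-rawRing (fromCommutativeRing R) morphism ι-≟ public
    using (Polynomial; solve; con; _:=_; _:+_; _:*_; _:-_; :-_)

-- Reasoning under double negation.

infixl 1 _>>=_

-- The target is an arbitrary negation. With `B` itself negated this is the usual bind; with `B` a
-- strict inequality it lets a double-negated case distinction prove a statement about `_≤_`.
_>>=_ : ∀ {a b} {A : Set a} {B : Set b} → ¬ ¬ A → (A → ¬ B) → ¬ B
(m >>= k) y = m λ x → k x y

return : ∀ {a} {A : Set a} → A → ¬ ¬ A
return x k = k x

-- Order and equality in the reals.

module OrderedField {c ℓ₁ ℓ₂} (R : RealNumbers c ℓ₁ ℓ₂) where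
  open RealNumbers R public
  open IntegerCoefficientSolver commutativeRing public

  :1 :0 : ∀ {n} → Polynomial n
  :1 = con (+ 1)
  :0 = con (+ 0)

  private variable
    x y z u v : Carrier

  -- Tightness makes `x ≈ y` equivalent to the negation of `x # y`, and negations are stable.
  ≈-stable : ¬ ¬ x ≈ y → x ≈ y
  ≈-stable {x} {y} h = proj₁ (tight x y) λ x#y → h λ x≈y → proj₂ (tight x y) x≈y x#y

  ≤-antisym : x ≤ y → y ≤ x → x ≈ y
  ≤-antisym {x} {y} x≤y y≤x = proj₁ (tight x y) λ x#y → [ y≤x , x≤y ]′ (#⇒<⊎> x#y)

  ≤-split : x ≤ y → ¬ ¬ (x < y ⊎ x ≈ y)
  ≤-split x≤y k = k (inj₂ (≤-antisym x≤y (k ∘ inj₁)))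

  <⇒≤ : x < y → x ≤ y
  <⇒≤ x<y y<x = <-asym x<y y<x

  ≤-reflexive : x ≈ y → x ≤ y
  ≤-reflexive x≈y = <-irrefl (sym x≈y)

  ≤-cases : ∀ x y → ¬ ¬ (x ≤ y ⊎ y < x)
  ≤-cases x y k = k (inj₁ (k ∘ inj₂))

  ≤-respʳ-≈ : y ≈ z → x ≤ y → x ≤ z
  ≤-respʳ-≈ y≈z x≤y z<x = x≤y (<-respˡ-≈ (sym y≈z) z<x)

  ≤-respˡ-≈ : x ≈ z → x ≤ y → z ≤ y
  ≤-respˡ-≈ x≈z x≤y y<z = x≤y (<-respʳ-≈ (sym x≈z) y<z)

  0<+ : 0# < x → 0# < y → 0# < x + y
  0<+ {x} {y} 0<x 0<y = <-trans 0<y (<-respˡ-≈ (+-identityˡ y) (+-monoˡ-< y 0<x))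

  0≤+ : 0# ≤ x → 0# ≤ y → 0# ≤ x + y
  0≤+ {x} {y} 0≤x 0≤y = do
    inj₁ 0<x ← ≤-split 0≤x
      where inj₂ 0≈x → ≤-respʳ-≈ (trans (sym (+-identityˡ y)) (+-congʳ 0≈x)) 0≤y
    inj₁ 0<y ← ≤-split 0≤y
      where inj₂ 0≈y → ≤-respʳ-≈ (trans (sym (+-identityʳ x)) (+-congˡ 0≈y)) 0≤x
    <⇒≤ (0<+ 0<x 0<y)

  0≤* : 0# ≤ x → 0# ≤ y → 0# ≤ x * y
  0≤* {x} {y} 0≤x 0≤y = do
    inj₁ 0<x ← ≤-split 0≤x
      where inj₂ 0≈x → ≤-reflexive (trans (sym (zeroˡ y)) (*-congʳ 0≈x))
    inj₁ 0<y ← ≤-split 0≤y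
      where inj₂ 0≈y → ≤-reflexive (trans (sym (zeroʳ x)) (*-congˡ 0≈y))
    <⇒≤ (*-pos 0<x 0<y)

  <⇒0<- : x < y → 0# < y - x
  <⇒0<- {x} {y} x<y = <-respˡ-≈ (-‿inverseʳ x) (+-monoˡ-< (- x) x<y)

  0<-⇒< : 0# < y - x → x < y
  0<-⇒< {y} {x} h = <-respʳ-≈ (solve 2 (λ x y → y :- x :+ x := y) refl x y)
    (<-respˡ-≈ (+-identityˡ x) (+-monoˡ-< x h))

  ≤⇒0≤- : x ≤ y → 0# ≤ y - x
  ≤⇒0≤- {x} {y} x≤y h = x≤y (<-respˡ-≈ (solve 2 (λ x y → y :- x :+ x := y) refl x y)
    (<-respʳ-≈ (+-identityˡ x) (+-monoˡ-< x h)))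

  0≤-⇒≤ : 0# ≤ y - x → x ≤ y
  0≤-⇒≤ {y} {x} h y<x = h (<-respʳ-≈ (-‿inverseʳ x) (+-monoˡ-< (- x) y<x))

  ≤-from : y - x ≈ z → 0# ≤ z → x ≤ y
  ≤-from e 0≤z = 0≤-⇒≤ (≤-respʳ-≈ (sym e) 0≤z)

  ≤-trans : x ≤ y → y ≤ z → x ≤ z
  ≤-trans {x} {y} {z} x≤y y≤z =
    ≤-from (solve 3 (λ x y z → z :- x := (z :- y) :+ (y :- x)) refl x y z)
      (0≤+ (≤⇒0≤- y≤z) (≤⇒0≤- x≤y))

  -- A strict inequality is positive information and cannot be had by contradiction. Cotransitivity
  -- of `_#_` places `z` apart from `x` or from `y`, and `y ≤ z` discards the wrong orders.
  <-≤-trans : x < y → y ≤ z → x < z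
  <-≤-trans {x} {y} {z} x<y y≤z with #-cotrans (<⇒# x<y) z
  ... | inj₁ x#z = [ (λ x<z → x<z) , (λ z<x → contradiction (<-trans z<x x<y) y≤z) ]′ (#⇒<⊎> x#z)
  ... | inj₂ z#y = [ (λ z<y → contradiction z<y y≤z) , <-trans x<y ]′ (#⇒<⊎> z#y)

  *-mono-≤ : 0# ≤ x → 0# ≤ u → x ≤ y → u ≤ v → x * u ≤ y * v
  *-mono-≤ {x} {u} {y} {v} 0≤x 0≤u x≤y u≤v =
    ≤-from (solve 4 (λ x u y v → y :* v :- x :* u := (y :- x) :* ((v :- u) :+ u) :+ x :* (v :- u)) refl x u y v)
      (0≤+ (0≤* (≤⇒0≤- x≤y) (0≤+ (≤⇒0≤- u≤v) 0≤u)) (0≤* 0≤x (≤⇒0≤- u≤v)))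

  +-mono-≤ : x ≤ y → u ≤ v → x + u ≤ y + v
  +-mono-≤ {x} {y} {u} {v} x≤y u≤v =
    ≤-from (solve 4 (λ x u y v → y :+ v :- (x :+ u) := (y :- x) :+ (v :- u)) refl x u y v)
      (0≤+ (≤⇒0≤- x≤y) (≤⇒0≤- u≤v))

  -‿≈0⇒≈ : x - y ≈ 0# → x ≈ y
  -‿≈0⇒≈ {x} {y} h = trans (solve 2 (λ x y → x := (x :- y) :+ y) refl x y) (trans (+-congʳ h) (+-identityˡ y))

  ≈⇒-‿≈0 : x ≈ y → x - y ≈ 0#
  ≈⇒-‿≈0 {x} {y} h = trans (+-congʳ h) (-‿inverseʳ y)

  0≤+≈0⇒≈0ˡ : 0# ≤ x → 0# ≤ y → x + y ≈ 0# → x ≈ 0#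
  0≤+≈0⇒≈0ˡ {x} {y} 0≤x 0≤y h = ≤-antisym
    (≤-from (trans (solve 2 (λ x y → :0 :- x := y :- (x :+ y)) refl x y)
                   (trans (+-congˡ (-‿cong h)) (solve 1 (λ y → y :- :0 := y) refl y))) 0≤y)
    0≤x

  0≤+≈0⇒≈0ʳ : 0# ≤ x → 0# ≤ y → x + y ≈ 0# → y ≈ 0#
  0≤+≈0⇒≈0ʳ {x} {y} 0≤x 0≤y h = 0≤+≈0⇒≈0ˡ 0≤y 0≤x (trans (+-comm y x) h)

  0<⇒≉0 : 0# < x → ¬ x ≈ 0#
  0<⇒≉0 0<x x≈0 = <-irrefl (sym x≈0) 0<x

  *≈0⇒≈0 : 0# < x → x * y ≈ 0# → y ≈ 0#
  *≈0⇒≈0 {x} {y} 0<x h = proj₁ (tight y 0#) λ y#0 →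
    [ (λ y<0 → 0<⇒≉0 (*-pos 0<x (<⇒0<- y<0))
         (trans (solve 2 (λ x y → x :* (:0 :- y) := :0 :- x :* y) refl x y)
                (trans (+-congˡ (-‿cong h)) (-‿inverseʳ 0#))))
    , (λ 0<y → 0<⇒≉0 (*-pos 0<x 0<y) h) ]′ (#⇒<⊎> y#0)

  *-cancelˡ : 0# < x → x * y ≈ x * z → y ≈ z
  *-cancelˡ {x} {y} {z} 0<x h = -‿≈0⇒≈ (*≈0⇒≈0 0<x
    (trans (solve 3 (λ x y z → x :* (y :- z) := x :* y :- x :* z) refl x y z) (≈⇒-‿≈0 h)))

  *-cancelˡ-≤ : 0# < x → x * y ≤ x * z → y ≤ z
  *-cancelˡ-≤ {x} {y} {z} 0<x h z<y = h (0<-⇒<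
    (<-respʳ-≈ (solve 3 (λ x y z → x :* (y :- z) := x :* y :- x :* z) refl x y z) (*-pos 0<x (<⇒0<- z<y))))

  -- The chain `x * u ≤ y * u ≤ y * v ≤ x * u` closes up, and so does the one through `x * v`. The
  -- factor cancelled is `x * u` in both components, because only its positivity is given.
  *-mono-equality : 0# ≤ x → 0# ≤ u → x ≤ y → u ≤ v → 0# < x * u → y * v ≤ x * u → x ≈ y × u ≈ v
  *-mono-equality {x} {u} {y} {v} 0≤x 0≤u x≤y u≤v 0<xu yv≤xu =
      *-cancelˡ 0<xu (trans (solve 3 (λ x u z → x :* u :* z := x :* (z :* u)) refl x u x)
        (trans (*-congˡ xu≈yu) (solve 3 (λ x u z → x :* (z :* u) := x :* u :* z) refl x u y)))
    , *-cancelˡ 0<xu (trans (solve 3 (λ x u z → x :* u :* z := u :* (x :* z)) refl x u u)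
        (trans (*-congˡ xu≈xv) (solve 3 (λ x u z → u :* (x :* z) := x :* u :* z) refl x u v)))
    where
    xu≈yu : x * u ≈ y * u
    xu≈yu = ≤-antisym (*-mono-≤ 0≤x 0≤u x≤y (≤-reflexive refl))
      (≤-trans (*-mono-≤ (≤-trans 0≤x x≤y) 0≤u (≤-reflexive refl) u≤v) yv≤xu)

    xu≈xv : x * u ≈ x * v
    xu≈xv = ≤-antisym (*-mono-≤ 0≤x 0≤u (≤-reflexive refl) u≤v)
      (≤-trans (*-mono-≤ 0≤x (≤-trans 0≤u u≤v) x≤y (≤-reflexive refl)) yv≤xu)

  0≤1 : 0# ≤ 1#
  0≤1 = <⇒≤ 0<1

  0≤x² : ∀ x → 0# ≤ x * x
  0≤x² x = do
    inj₁ x≤0 ← ≤-cases x 0#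
      where inj₂ 0<x → <⇒≤ (*-pos 0<x 0<x)
    ≤-respʳ-≈ (solve 1 (λ x → (:0 :- x) :* (:0 :- x) := x :* x) refl x) (0≤* (≤⇒0≤- x≤0) (≤⇒0≤- x≤0))

  -- Built exactly as `½` is, so `inverse 0<2` is `½` by definition.
  inverse : 0# < x → Carrier
  inverse 0<x = proj₁ (#⇒invertible (#-sym (<⇒# 0<x)))

  *-inverse : (0<x : 0# < x) → x * inverse 0<x ≈ 1#
  *-inverse {x} 0<x = trans (solve 2 (λ x i → x :* i := (x :- :0) :* i) refl x (inverse 0<x))
    (proj₂ (proj₂ (#⇒invertible (#-sym (<⇒# 0<x)))))

  0<inverse : (0<x : 0# < x) → 0# < inverse 0<x
  0<inverse {x} 0<x = [ (λ i<0 → contradiction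
                           (<-respʳ-≈ (trans (solve 2 (λ x i → x :* (:0 :- i) := :0 :- x :* i) refl x (inverse 0<x))
                                             (+-congˡ (-‿cong (*-inverse 0<x))))
                              (*-pos 0<x (<⇒0<- i<0)))
                           (λ 0<-1 → <-asym 0<1 (0<-⇒< 0<-1)))
                      , (λ 0<i → 0<i) ]′ (#⇒<⊎> i#0)
    where
    i#0 : inverse 0<x # 0#
    i#0 = invertible⇒# (x , trans (solve 2 (λ x i → x :* (i :- :0) := x :* i) refl x (inverse 0<x)) (*-inverse 0<x)
                          , trans (solve 2 (λ x i → (i :- :0) :* x := x :* i) refl x (inverse 0<x)) (*-inverse 0<x))

-- The polynomial inequality behind the mixing step.

module MixedSections {c ℓ₁ ℓ₂} (R : RealNumbers c ℓ₁ ℓ₂) where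
  open OrderedField R

  x²≈0⇒x≈0 : ∀ {x} → x * x ≈ 0# → x ≈ 0#
  x²≈0⇒x≈0 {x} h = proj₁ (tight x 0#) λ x#0 →
    [ (λ x<0 → <-irrefl (*≈0⇒≈0 (<⇒0<- x<0)
         (trans (solve 1 (λ x → (:0 :- x) :* x := :0 :- x :* x) refl x)
                (trans (+-congˡ (-‿cong h)) (-‿inverseʳ 0#)))) x<0)
    , (λ 0<x → 0<⇒≉0 0<x (*≈0⇒≈0 0<x h)) ]′ (#⇒<⊎> x#0)

  +-zeroˡ : ∀ {x y} → x ≈ 0# → x + y ≈ y
  +-zeroˡ h = trans (+-congʳ h) (+-identityˡ _)

  +-zeroʳ : ∀ {x y} → y ≈ 0# → x + y ≈ x
  +-zeroʳ h = trans (+-congˡ h) (+-identityʳ _)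

  *-zeroʳ′ : ∀ {x y} → y ≈ 0# → x * y ≈ 0#
  *-zeroʳ′ h = trans (*-congˡ h) (zeroʳ _)

  *-zeroˡ′ : ∀ {x y} → x ≈ 0# → x * y ≈ 0#
  *-zeroˡ′ h = trans (*-congʳ h) (zeroˡ _)

  1-‿anti : ∀ {x y} → x ≤ y → 1# - y ≤ 1# - x
  1-‿anti {x} {y} h = ≤-from (solve 2 (λ x y → :1 :- x :- (:1 :- y) := y :- x) refl x y) (≤⇒0≤- h)

  -- With x = a₀ / κ and y = b₀ / κ, the measures (a , b) after mixing satisfy
  -- Gx * Gy * (a * b) ≤ lhs * (p₁ * p₂), so that a * b ≤ p₁ * p₂ becomes lhs ≤ Gx * Gy.
  module Core (α β κ x y : Carrier) where
    Gx Gy lhs slack U V : Carrier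
    Gx    = 1# + (1# - κ) * x
    Gy    = 1# + (1# - κ) * y
    lhs   = (1# - κ * y + β * x * Gy) * (1# - κ * x + α * y * Gx)
    slack = κ * ((x - y) * (x - y))
            + (1# - κ) * (1# - κ) * (x * y) * (1# - κ + (κ * (1# - y) + y * (1# - κ * x)))
    U     = y * Gx * (1# - κ * y)
    V     = x * Gy * (1# - κ * x)

    remainder : Carrier
    remainder = (1# - κ) * y * (1# - κ * y - x * Gy)
                + ((1# - β) * (V - U) + (1# - α) * (1# - β) * U)

    -- A certificate of nonnegativity. The last summand vanishes once `κ ≈ α * β`; it is written out
    -- because the solver cannot use hypotheses. `slack` decides the equality case, while
    -- `remainder` collects the terms controlled by `xGy≤`, `U≤V` and `α , β ≤ 1`.
    identity : Gx * Gy - lhs ≈ slack + remainder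
                 + (κ - α * β) * (x * y * (Gx * Gy) + U)
    identity = solve 5 (λ α β κ x y →
      let l = :1 :- κ ; gx = :1 :+ l :* x ; gy = :1 :+ l :* y
          u = y :* gx :* (:1 :- κ :* y) ; v = x :* gy :* (:1 :- κ :* x) in
      gx :* gy :- (:1 :- κ :* y :+ β :* x :* gy) :* (:1 :- κ :* x :+ α :* y :* gx)
      := κ :* ((x :- y) :* (x :- y))
         :+ l :* l :* (x :* y) :* (l :+ (κ :* (:1 :- y) :+ y :* (:1 :- κ :* x)))
         :+ (l :* y :* (:1 :- κ :* y :- x :* gy)
             :+ ((:1 :- β) :* (v :- u) :+ (:1 :- α) :* (:1 :- β) :* u))
         :+ (κ :- α :* β) :* (x :* y :* (gx :* gy) :+ u)) refl α β κ x y

    module _ (κ≈αβ : κ ≈ α * β) (0<κ : 0# < κ) (κ≤1 : κ ≤ 1#) (α≤1 : α ≤ 1#) (β≤1 : β ≤ 1#)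
             (0≤x : 0# ≤ x) (x≤1 : x ≤ 1#) (0≤y : 0# ≤ y) (y≤1 : y ≤ 1#)
             (κx≤1 : κ * x ≤ 1#) (κy≤1 : κ * y ≤ 1#)
             (xGy≤ : x * Gy ≤ 1# - κ * y) (U≤V : U ≤ V) where

      private
        0≤λ : 0# ≤ 1# - κ
        0≤λ = ≤⇒0≤- κ≤1

        0≤last : 0# ≤ κ * (1# - y) + y * (1# - κ * x)
        0≤last = 0≤+ (0≤* (<⇒≤ 0<κ) (≤⇒0≤- y≤1)) (0≤* 0≤y (≤⇒0≤- κx≤1))

        0≤left : 0# ≤ κ * ((x - y) * (x - y))
        0≤left = 0≤* (<⇒≤ 0<κ) (0≤x² (x - y))

        0≤right : 0# ≤ (1# - κ) * (1# - κ) * (x * y) * (1# - κ + (κ * (1# - y) + y * (1# - κ * x)))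
        0≤right = 0≤* (0≤* (0≤* 0≤λ 0≤λ) (0≤* 0≤x 0≤y)) (0≤+ 0≤λ 0≤last)

        0≤slack : 0# ≤ slack
        0≤slack = 0≤+ 0≤left 0≤right

        0≤remainder : 0# ≤ remainder
        0≤remainder = 0≤+ (0≤* (0≤* 0≤λ 0≤y) (≤⇒0≤- xGy≤))
          (0≤+ (0≤* (≤⇒0≤- β≤1) (≤⇒0≤- U≤V))
               (0≤* (0≤* (≤⇒0≤- α≤1) (≤⇒0≤- β≤1))
                    (0≤* (0≤* 0≤y (0≤+ 0≤1 (0≤* 0≤λ 0≤x))) (≤⇒0≤- κy≤1))))

        gap : Gx * Gy - lhs ≈ slack + remainder
        gap = trans identity (+-zeroʳ (*-zeroˡ′ (≈⇒-‿≈0 κ≈αβ)))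

      bound : lhs ≤ Gx * Gy
      bound = ≤-from gap (0≤+ 0≤slack 0≤remainder)

      -- `slack` alone suffices: its first summand gives `x ≈ y`, and then its second, whose
      -- remaining factors are positive for `κ < 1`, gives `x * x ≈ 0`.
      equality : κ < 1# → lhs ≈ Gx * Gy → x ≈ 0# × y ≈ 0#
      equality κ<1 e = x≈0 , trans (sym x≈y) x≈0
        where
        0<λ : 0# < 1# - κ
        0<λ = <⇒0<- κ<1

        slack≈0 : slack ≈ 0#
        slack≈0 = 0≤+≈0⇒≈0ˡ 0≤slack 0≤remainder (trans (sym gap) (≈⇒-‿≈0 (sym e)))

        x≈y : x ≈ y
        x≈y = -‿≈0⇒≈ (x²≈0⇒x≈0 (*≈0⇒≈0 0<κ (0≤+≈0⇒≈0ˡ 0≤left 0≤right slack≈0)))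

        xy≈0 : x * y ≈ 0#
        xy≈0 = *≈0⇒≈0 (*-pos 0<λ 0<λ) (*≈0⇒≈0 0<last
          (trans (*-comm _ _) (0≤+≈0⇒≈0ʳ 0≤left 0≤right slack≈0)))
          where
          0<last : 0# < 1# - κ + (κ * (1# - y) + y * (1# - κ * x))
          0<last = <-≤-trans 0<λ (≤-from (solve 2 (λ l s → l :+ s :- l := s) refl _ _) 0≤last)

        x≈0 : x ≈ 0#
        x≈0 = x²≈0⇒x≈0 (trans (*-congˡ x≈y) xy≈0)

  module _ {α β κ x y : Carrier} (κ≈αβ : κ ≈ α * β) (0<κ : 0# < κ) (κ≤1 : κ ≤ 1#)
           (0≤α : 0# ≤ α) (α≤1 : α ≤ 1#) (0≤β : 0# ≤ β) (β≤1 : β ≤ 1#)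
           (0≤x : 0# ≤ x) (0≤y : 0# ≤ y) where
    private
      Gx Gy : Carrier
      Gx = 1# + (1# - κ) * x
      Gy = 1# + (1# - κ) * y

    module _ {a b : Carrier} (x≤a : x ≤ a) (a≤1 : a ≤ 1#) (y≤b : y ≤ b) (b≤1 : b ≤ 1#)
             (aGy≤ : a * Gy ≤ 1# - κ * y) (bGx≤ : b * Gx ≤ 1# - κ * x) where
      private
        module XY = Core α β κ x y
        module YX = Core β α κ y x

        x≤1 : x ≤ 1#
        x≤1 = ≤-trans x≤a a≤1

        y≤1 : y ≤ 1#
        y≤1 = ≤-trans y≤b b≤1

        0≤λ : 0# ≤ 1# - κ
        0≤λ = ≤⇒0≤- κ≤1

        0<1+λ : ∀ {z} → 0# ≤ z → 0# < 1# + (1# - κ) * z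
        0<1+λ {z} 0≤z = <-≤-trans 0<1 (≤-from (solve 1 (λ s → :1 :+ s :- :1 := s) refl ((1# - κ) * z)) (0≤* 0≤λ 0≤z))

        κ*≤1 : ∀ {z} → 0# ≤ z → z ≤ 1# → κ * z ≤ 1#
        κ*≤1 0≤z z≤1 = ≤-respʳ-≈ (*-identityˡ 1#) (*-mono-≤ (<⇒≤ 0<κ) 0≤z κ≤1 z≤1)

        0<Gx : 0# < Gx
        0<Gx = 0<1+λ 0≤x

        0<Gy : 0# < Gy
        0<Gy = 0<1+λ 0≤y

        xGy≤ : x * Gy ≤ 1# - κ * y
        xGy≤ = ≤-trans (*-mono-≤ 0≤x (<⇒≤ 0<Gy) x≤a (≤-reflexive refl)) aGy≤

        yGx≤ : y * Gx ≤ 1# - κ * x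
        yGx≤ = ≤-trans (*-mono-≤ 0≤y (<⇒≤ 0<Gx) y≤b (≤-reflexive refl)) bGx≤

        κ≈βα : κ ≈ β * α
        κ≈βα = trans κ≈αβ (*-comm α β)

        lhs≤ : XY.lhs ≤ Gx * Gy
        lhs≤ = ≤-cases XY.U XY.V >>= λ where
          (inj₁ U≤V) → XY.bound κ≈αβ 0<κ κ≤1 α≤1 β≤1 0≤x x≤1 0≤y y≤1 (κ*≤1 0≤x x≤1) (κ*≤1 0≤y y≤1) xGy≤ U≤V
          -- Exchanging the two families, that is `x` with `y` and `α` with `β`, interchanges `U`
          -- and `V`.
          (inj₂ V<U) → ≤-respʳ-≈ (*-comm _ _) (≤-respˡ-≈ (*-comm _ _)
            (YX.bound κ≈βα 0<κ κ≤1 β≤1 α≤1 0≤y y≤1 0≤x x≤1 (κ*≤1 0≤y y≤1) (κ*≤1 0≤x x≤1) yGx≤ (<⇒≤ V<U)))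

        lhs≈⇒ : κ < 1# → XY.lhs ≈ Gx * Gy → ¬ ¬ (x ≈ 0# × y ≈ 0#)
        lhs≈⇒ κ<1 e = ≤-cases XY.U XY.V >>= λ where
          (inj₁ U≤V) → return (XY.equality κ≈αβ 0<κ κ≤1 α≤1 β≤1 0≤x x≤1 0≤y y≤1 (κ*≤1 0≤x x≤1) (κ*≤1 0≤y y≤1) xGy≤ U≤V κ<1 e)
          (inj₂ V<U) → return (let y≈0 , x≈0 = YX.equality κ≈βα 0<κ κ≤1 β≤1 α≤1 0≤y y≤1 0≤x x≤1 (κ*≤1 0≤y y≤1) (κ*≤1 0≤x x≤1) yGx≤ (<⇒≤ V<U)
                                                     κ<1 (trans (*-comm _ _) (trans e (*-comm _ _)))
                                in x≈0 , y≈0)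

        E : Carrier
        E = (a + β * x) * (b + α * y)

        -- The caps replace `a` by `(1 - κ y) / Gy` and `b` by `(1 - κ x) / Gx`; multiplying by
        -- `Gx * Gy` clears the denominators.
        E≤lhs : Gx * Gy * E ≤ XY.lhs
        E≤lhs = ≤-respˡ-≈
          (solve 6 (λ gx gy a b s t → (a :* gy :+ s :* gy) :* (b :* gx :+ t :* gx)
                       := gx :* gy :* ((a :+ s) :* (b :+ t))) refl Gx Gy a b (β * x) (α * y))
          (*-mono-≤ (0≤+ (0≤* (≤-trans 0≤x x≤a) (<⇒≤ 0<Gy)) (0≤* (0≤* 0≤β 0≤x) (<⇒≤ 0<Gy)))
                    (0≤+ (0≤* (≤-trans 0≤y y≤b) (<⇒≤ 0<Gx)) (0≤* (0≤* 0≤α 0≤y) (<⇒≤ 0<Gx)))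
                    (+-mono-≤ aGy≤ (≤-reflexive refl))
                    (+-mono-≤ bGx≤ (≤-reflexive refl)))

        0<GG : 0# < Gx * Gy
        0<GG = *-pos 0<Gx 0<Gy

      mixed-bound : (a + β * x) * (b + α * y) ≤ 1#
      mixed-bound = *-cancelˡ-≤ 0<GG (≤-respʳ-≈ (sym (*-identityʳ _)) (≤-trans E≤lhs lhs≤))

      mixed-equality : κ < 1# → (a + β * x) * (b + α * y) ≈ 1# →
                       ¬ ¬ (x ≈ 0# × y ≈ 0# × a ≈ 1# × b ≈ 1#)
      mixed-equality κ<1 e = lhs≈⇒ κ<1 lhs≈GG >>= λ (x≈0 , y≈0) → return (x≈0 , y≈0 , finish x≈0 y≈0)
        where
        lhs≈GG : XY.lhs ≈ Gx * Gy
        lhs≈GG = ≤-antisym lhs≤ (≤-respˡ-≈ (trans (*-congˡ e) (*-identityʳ _)) E≤lhs)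

        finish : x ≈ 0# → y ≈ 0# → a ≈ 1# × b ≈ 1#
        finish x≈0 y≈0 = a≈1 , trans (sym (*-identityˡ b)) (trans (*-congʳ (sym a≈1)) ab≈1)
          where
          ab≈1 : a * b ≈ 1#
          ab≈1 = trans (*-cong (sym (+-zeroʳ (*-zeroʳ′ x≈0))) (sym (+-zeroʳ (*-zeroʳ′ y≈0)))) e

          a≈1 : a ≈ 1#
          a≈1 = ≤-antisym a≤1 (≤-respˡ-≈ ab≈1 (≤-respʳ-≈ (*-identityʳ a)
                  (*-mono-≤ (≤-trans 0≤x x≤a) (≤-trans 0≤y y≤b) (≤-reflexive refl) b≤1)))

-- The feasible region and its stability under mixing.

module Regions {c ℓ₁ ℓ₂} (R : RealNumbers c ℓ₁ ℓ₂) where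
  open OrderedField R
  open MixedSections R

  mix : Carrier → Carrier → Carrier → Carrier
  mix p a b = p * a + (1# - p) * b

  0≤mix : ∀ {p a b} → 0# ≤ p → p ≤ 1# → 0# ≤ a → 0# ≤ b → 0# ≤ mix p a b
  0≤mix 0≤p p≤1 0≤a 0≤b = 0≤+ (0≤* 0≤p 0≤a) (0≤* (≤⇒0≤- p≤1) 0≤b)

  mix≤1 : ∀ {p a b} → 0# ≤ p → p ≤ 1# → a ≤ 1# → b ≤ 1# → mix p a b ≤ 1#
  mix≤1 {p} {a} {b} 0≤p p≤1 a≤1 b≤1 =
    ≤-from (solve 3 (λ p a b → :1 :- (p :* a :+ (:1 :- p) :* b) := p :* (:1 :- a) :+ (:1 :- p) :* (:1 :- b)) refl p a b)
      (0≤mix 0≤p p≤1 (≤⇒0≤- a≤1) (≤⇒0≤- b≤1))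

  mix≤ˡ : ∀ {p a b} → p ≤ 1# → b ≤ a → mix p a b ≤ a
  mix≤ˡ {p} {a} {b} p≤1 b≤a =
    ≤-from (solve 3 (λ p a b → a :- (p :* a :+ (:1 :- p) :* b) := (:1 :- p) :* (a :- b)) refl p a b)
      (0≤* (≤⇒0≤- p≤1) (≤⇒0≤- b≤a))

  module _ (p₁ p₂ : Carrier) where
    P Q : Carrier
    P = p₁ * p₂
    Q = (1# - p₁) * (1# - p₂)

    -- `odds≤` bounds the product of the odds `a / (1 - a)` and `b / (1 - b)` by that of `p₁` and
    -- `p₂`. Clearing denominators keeps the values `a ≈ 1` and `b ≈ 1` admissible.
    record Feasible (a b : Carrier) : Set ℓ₂ where
      field
        0≤a      : 0# ≤ a
        a≤1      : a ≤ 1#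
        0≤b      : 0# ≤ b
        b≤1      : b ≤ 1#
        product≤ : a * b ≤ P
        odds≤    : Q * (a * b) ≤ P * ((1# - a) * (1# - b))

  module Cross {p₁ p₂ a₁ a₀ b₁ b₀ : Carrier} (0<p₁ : 0# < p₁) (0<p₂ : 0# < p₂)
               (0<q₁ : 0# < 1# - p₁) (0<q₂ : 0# < 1# - p₂)
               (X≤P : a₁ * b₀ ≤ P p₁ p₂) (Y≤P : a₀ * b₁ ≤ P p₁ p₂) (b₀≤b₁ : b₀ ≤ b₁)
               (h : P p₁ p₂ * a₁ < Q p₁ p₂ * a₀) where
    private
      dX dY dZ : Carrier
      dX = (P p₁ p₂ + p₁ * (1# - p₂)) * (P p₁ p₂ - a₁ * b₀)
      dY = ((1# - p₁) * p₂ + Q p₁ p₂) * (P p₁ p₂ - a₀ * b₁)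
      dZ = (Q p₁ p₂ * a₀ - P p₁ p₂ * a₁) * (b₁ - b₀)

      -- The coefficients of `dX` and `dY` are `p₁` and `1 - p₁`, written as sums of positive
      -- products. The mixed product is thus the weighted mean of `a₁ * b₀` and `a₀ * b₁`, less
      -- `dZ`, which `h` makes nonnegative.
      gap : P p₁ p₂ - mix p₁ a₁ a₀ * mix p₂ b₁ b₀ ≈ dX + (dY + dZ)
      gap = solve 6 (λ p₁ p₂ a₁ a₀ b₁ b₀ →
        let q₁ = :1 :- p₁ ; q₂ = :1 :- p₂ ; P = p₁ :* p₂ ; Q = q₁ :* q₂ in
        P :- (p₁ :* a₁ :+ q₁ :* a₀) :* (p₂ :* b₁ :+ q₂ :* b₀)
        := (P :+ p₁ :* q₂) :* (P :- a₁ :* b₀)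
           :+ ((q₁ :* p₂ :+ Q) :* (P :- a₀ :* b₁) :+ (Q :* a₀ :- P :* a₁) :* (b₁ :- b₀)))
        refl p₁ p₂ a₁ a₀ b₁ b₀

      0<P : 0# < P p₁ p₂
      0<P = *-pos 0<p₁ 0<p₂

      0<cX : 0# < P p₁ p₂ + p₁ * (1# - p₂)
      0<cX = 0<+ 0<P (*-pos 0<p₁ 0<q₂)

      0<cY : 0# < (1# - p₁) * p₂ + Q p₁ p₂
      0<cY = 0<+ (*-pos 0<q₁ 0<p₂) (*-pos 0<q₁ 0<q₂)

      0≤dX : 0# ≤ dX
      0≤dX = 0≤* (<⇒≤ 0<cX) (≤⇒0≤- X≤P)

      0≤dY : 0# ≤ dY
      0≤dY = 0≤* (<⇒≤ 0<cY) (≤⇒0≤- Y≤P)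

      0≤dZ : 0# ≤ dZ
      0≤dZ = 0≤* (<⇒≤ (<⇒0<- h)) (≤⇒0≤- b₀≤b₁)

    bound : mix p₁ a₁ a₀ * mix p₂ b₁ b₀ ≤ P p₁ p₂
    bound = ≤-from gap (0≤+ 0≤dX (0≤+ 0≤dY 0≤dZ))

    equality : mix p₁ a₁ a₀ * mix p₂ b₁ b₀ ≈ P p₁ p₂ → a₁ ≈ a₀ × b₁ ≈ b₀
    equality e = a₁≈a₀ , b₁≈b₀
      where
      sum≈0 : dX + (dY + dZ) ≈ 0#
      sum≈0 = trans (sym gap) (≈⇒-‿≈0 (sym e))

      rest≈0 : dY + dZ ≈ 0#
      rest≈0 = 0≤+≈0⇒≈0ʳ 0≤dX (0≤+ 0≤dY 0≤dZ) sum≈0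

      P≈X : P p₁ p₂ ≈ a₁ * b₀
      P≈X = -‿≈0⇒≈ (*≈0⇒≈0 0<cX (0≤+≈0⇒≈0ˡ 0≤dX (0≤+ 0≤dY 0≤dZ) sum≈0))

      P≈Y : P p₁ p₂ ≈ a₀ * b₁
      P≈Y = -‿≈0⇒≈ (*≈0⇒≈0 0<cY (0≤+≈0⇒≈0ˡ 0≤dY 0≤dZ rest≈0))

      b₁≈b₀ : b₁ ≈ b₀
      b₁≈b₀ = -‿≈0⇒≈ (*≈0⇒≈0 (<⇒0<- h) (0≤+≈0⇒≈0ʳ 0≤dY 0≤dZ rest≈0))

      a₁≈a₀ : a₁ ≈ a₀
      -- The factor cancelled is `b₀ * a₁`, positive because it equals `P`; no positivity of `b₀`
      -- alone is at hand.
      a₁≈a₀ = *-cancelˡ (<-respʳ-≈ (trans P≈X (*-comm _ _)) 0<P)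
        (trans (solve 3 (λ b a u → b :* a :* u := a :* (u :* b)) refl b₀ a₁ a₁)
        (trans (*-congˡ (trans (sym P≈X) (trans P≈Y (*-congˡ b₁≈b₀))))
               (solve 3 (λ b a u → a :* (u :* b) := b :* a :* u) refl b₀ a₁ a₀)))

  module Step (p₁ p₂ : Carrier) (0<p₁ : 0# < p₁) (0<p₂ : 0# < p₂)
              (p₁≤q₁ : p₁ ≤ 1# - p₁) (p₂≤q₂ : p₂ ≤ 1# - p₂) where
    private
      q₁ q₂ : Carrier
      q₁ = 1# - p₁
      q₂ = 1# - p₂

    0<q₁ : 0# < q₁
    0<q₁ = <-≤-trans 0<p₁ p₁≤q₁

    0<q₂ : 0# < q₂
    0<q₂ = <-≤-trans 0<p₂ p₂≤q₂

    p₁≤1 : p₁ ≤ 1#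
    p₁≤1 = 0≤-⇒≤ (<⇒≤ 0<q₁)

    p₂≤1 : p₂ ≤ 1#
    p₂≤1 = 0≤-⇒≤ (<⇒≤ 0<q₂)

    0<P : 0# < P p₁ p₂
    0<P = *-pos 0<p₁ 0<p₂

    0<Q : 0# < Q p₁ p₂
    0<Q = *-pos 0<q₁ 0<q₂

    P≤Q : P p₁ p₂ ≤ Q p₁ p₂
    P≤Q = *-mono-≤ (<⇒≤ 0<p₁) (<⇒≤ 0<p₂) p₁≤q₁ p₂≤q₂

    -- The two odds and their product `P / Q`. Taking `κ` to be `α * β` literally makes the
    -- hypothesis `κ ≈ α * β` of the mixing inequality hold by `refl`.
    α β κ : Carrier
    α = p₁ * inverse 0<q₁
    β = p₂ * inverse 0<q₂
    κ = α * β

    ratio : ∀ {p q} (0<q : 0# < q) → q * (p * inverse 0<q) ≈ p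
    ratio {p} {q} 0<q = trans (solve 3 (λ p q i → q :* (p :* i) := p :* (q :* i)) refl p q (inverse 0<q))
                              (trans (*-congˡ (*-inverse 0<q)) (*-identityʳ p))

    ratio≤1 : ∀ {p q} (0<q : 0# < q) → p ≤ q → p * inverse 0<q ≤ 1#
    ratio≤1 {p} {q} 0<q p≤q = *-cancelˡ-≤ 0<q (≤-respˡ-≈ (sym (ratio 0<q)) (≤-respʳ-≈ (sym (*-identityʳ q)) p≤q))

    0<α : 0# < α
    0<α = *-pos 0<p₁ (0<inverse 0<q₁)

    0<β : 0# < β
    0<β = *-pos 0<p₂ (0<inverse 0<q₂)

    0<κ : 0# < κ
    0<κ = *-pos 0<α 0<β

    α≤1 : α ≤ 1#
    α≤1 = ratio≤1 0<q₁ p₁≤q₁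

    β≤1 : β ≤ 1#
    β≤1 = ratio≤1 0<q₂ p₂≤q₂

    κ≤1 : κ ≤ 1#
    κ≤1 = ≤-respʳ-≈ (*-identityˡ 1#) (*-mono-≤ (<⇒≤ 0<α) (<⇒≤ 0<β) α≤1 β≤1)

    Qκ≈P : Q p₁ p₂ * κ ≈ P p₁ p₂
    Qκ≈P = trans (solve 4 (λ q r s t → q :* r :* (s :* t) := q :* s :* (r :* t)) refl q₁ q₂ α β)
                 (*-cong (ratio 0<q₁) (ratio 0<q₂))

    module _ {a₁ a₀ b₁ b₀ : Carrier} (F₁ : Feasible p₁ p₂ a₁ b₀) (F₀ : Feasible p₁ p₂ a₀ b₁)
             (a₀≤a₁ : a₀ ≤ a₁) (b₀≤b₁ : b₀ ≤ b₁) where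
      private
        module F₁ = Feasible F₁
        module F₀ = Feasible F₀
        a b : Carrier
        a = mix p₁ a₁ a₀
        b = mix p₂ b₁ b₀
        a≤a₁ : a ≤ a₁
        a≤a₁ = mix≤ˡ p₁≤1 a₀≤a₁
        b≤b₁ : b ≤ b₁
        b≤b₁ = mix≤ˡ p₂≤1 b₀≤b₁
        0≤a : 0# ≤ a
        0≤a = 0≤mix (<⇒≤ 0<p₁) p₁≤1 F₁.0≤a F₀.0≤a
        0≤b : 0# ≤ b
        0≤b = 0≤mix (<⇒≤ 0<p₂) p₂≤1 F₀.0≤b F₁.0≤b

        module Odds where
          W : Carrier → Carrier
          W z = Q p₁ p₂ * z + P p₁ p₂ * (1# - z)

          0<W : ∀ {z} → 0# ≤ z → 0# < W z
          0<W {z} 0≤z = <-≤-trans 0<P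
            (≤-from (solve 3 (λ p q z → q :* z :+ p :* (:1 :- z) :- p := (q :- p) :* z) refl (P p₁ p₂) (Q p₁ p₂) z)
              (0≤* (≤⇒0≤- P≤Q) 0≤z))

          W≤Q : ∀ {z} → z ≤ 1# → W z ≤ Q p₁ p₂
          W≤Q {z} z≤1 =
            ≤-from (solve 3 (λ p q z → q :- (q :* z :+ p :* (:1 :- z)) := (q :- p) :* (:1 :- z)) refl (P p₁ p₂) (Q p₁ p₂) z)
              (0≤* (≤⇒0≤- P≤Q) (≤⇒0≤- z≤1))

          -- The odds constraint between u and z, solved for u.
          section≤ : ∀ {u z} → Q p₁ p₂ * (u * z) ≤ P p₁ p₂ * ((1# - u) * (1# - z)) → u * W z ≤ P p₁ p₂ * (1# - z)
          section≤ {u} {z} h =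
            ≤-from (solve 4 (λ p q u z → p :* (:1 :- z) :- u :* (q :* z :+ p :* (:1 :- z))
                                  := p :* ((:1 :- u) :* (:1 :- z)) :- q :* (u :* z)) refl (P p₁ p₂) (Q p₁ p₂) u z)
              (≤⇒0≤- h)

          -- `M₁` and `M₂` are `a * W b₁` and `b * W a₁` with `a₀` and `b₀` at the largest values
          -- that the odds constraints allow. `N₁` and `N₂` are the complements `W b₁ - M₁` and
          -- `W a₁ - M₂`.
          M₁ M₂ N₁ N₂ : Carrier
          M₁ = p₁ * a₁ * W b₁ + q₁ * (P p₁ p₂ * (1# - b₁))
          M₂ = p₂ * b₁ * W a₁ + q₂ * (P p₁ p₂ * (1# - a₁))
          N₁ = p₁ * (1# - a₁) * W b₁ + q₁ * (Q p₁ p₂ * b₁)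
          N₂ = p₂ * (1# - b₁) * W a₁ + q₂ * (Q p₁ p₂ * a₁)

          aW≤ : a * W b₁ ≤ M₁
          aW≤ = ≤-from (solve 5 (λ p a₁ a₀ w m → p :* a₁ :* w :+ (:1 :- p) :* m :- (p :* a₁ :+ (:1 :- p) :* a₀) :* w
                                    := (:1 :- p) :* (m :- a₀ :* w)) refl p₁ a₁ a₀ (W b₁) (P p₁ p₂ * (1# - b₁)))
                  (0≤* (<⇒≤ 0<q₁) (≤⇒0≤- (section≤ F₀.odds≤)))

          bW≤ : b * W a₁ ≤ M₂
          bW≤ = ≤-from (solve 5 (λ p a₁ a₀ w m → p :* a₁ :* w :+ (:1 :- p) :* m :- (p :* a₁ :+ (:1 :- p) :* a₀) :* w
                                    := (:1 :- p) :* (m :- a₀ :* w)) refl p₂ b₁ b₀ (W a₁) (P p₁ p₂ * (1# - a₁)))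
                  (0≤* (<⇒≤ 0<q₂) (≤⇒0≤- (section≤ (≤-respˡ-≈ (*-congˡ (*-comm _ _)) (≤-respʳ-≈ (*-congˡ (*-comm _ _)) F₁.odds≤)))))

          N₁≤ : N₁ ≤ (1# - a) * W b₁
          N₁≤ = ≤-from (solve 6 (λ p q x u s z →
                    let w = q :* z :+ x :* (:1 :- z) in
                    (:1 :- (p :* u :+ (:1 :- p) :* s)) :* w :- (p :* (:1 :- u) :* w :+ (:1 :- p) :* (q :* z))
                    := p :* u :* w :+ (:1 :- p) :* (x :* (:1 :- z)) :- (p :* u :+ (:1 :- p) :* s) :* w)
                    refl p₁ (Q p₁ p₂) (P p₁ p₂) a₁ a₀ b₁) (≤⇒0≤- aW≤)

          N₂≤ : N₂ ≤ (1# - b) * W a₁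
          N₂≤ = ≤-from (solve 6 (λ p q x u s z →
                    let w = q :* z :+ x :* (:1 :- z) in
                    (:1 :- (p :* u :+ (:1 :- p) :* s)) :* w :- (p :* (:1 :- u) :* w :+ (:1 :- p) :* (q :* z))
                    := p :* u :* w :+ (:1 :- p) :* (x :* (:1 :- z)) :- (p :* u :+ (:1 :- p) :* s) :* w)
                    refl p₂ (Q p₁ p₂) (P p₁ p₂) b₁ b₀ a₁) (≤⇒0≤- bW≤)

          0<WW : 0# < W b₁ * W a₁
          0<WW = *-pos (0<W F₀.0≤b) (0<W F₁.0≤a)

          0≤aW : 0# ≤ a * W b₁
          0≤aW = 0≤* 0≤a (<⇒≤ (0<W F₀.0≤b))

          0≤bW : 0# ≤ b * W a₁
          0≤bW = 0≤* 0≤b (<⇒≤ (0<W F₁.0≤a))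

          0≤N : ∀ {p q u z w} → 0# ≤ p → 0# ≤ q → u ≤ 1# → 0# ≤ w → 0# ≤ z → 0# ≤ p * (1# - u) * w + q * (Q p₁ p₂ * z)
          0≤N 0≤p 0≤q u≤1 0≤w 0≤z = 0≤+ (0≤* (0≤* 0≤p (≤⇒0≤- u≤1)) 0≤w) (0≤* 0≤q (0≤* (<⇒≤ 0<Q) 0≤z))

          -- After expansion the terms with just one of `W b₁` and `W a₁` cancel. The difference
          -- factors into the excess given by the hypothesis times `P * (Q * Q - W b₁ * W a₁)`,
          -- nonnegative by `W≤Q`.
          M≤N : P p₁ p₂ * ((1# - a₁) * (1# - b₁)) ≤ Q p₁ p₂ * (a₁ * b₁) → Q p₁ p₂ * (M₁ * M₂) ≤ P p₁ p₂ * (N₁ * N₂)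
          M≤N h = ≤-from (solve 8 (λ p₁ p₂ P Q u z v w →
              let q₁ = :1 :- p₁ ; q₂ = :1 :- p₂ in
              P :* ((p₁ :* (:1 :- u) :* v :+ q₁ :* (Q :* z)) :* (p₂ :* (:1 :- z) :* w :+ q₂ :* (Q :* u)))
              :- Q :* ((p₁ :* u :* v :+ q₁ :* (P :* (:1 :- z))) :* (p₂ :* z :* w :+ q₂ :* (P :* (:1 :- u))))
              := (Q :* (u :* z) :- P :* ((:1 :- u) :* (:1 :- z))) :* (P :* Q :* (q₁ :* q₂) :- p₁ :* p₂ :* (v :* w)))
              refl p₁ p₂ (P p₁ p₂) (Q p₁ p₂) a₁ b₁ (W b₁) (W a₁))
            (0≤* (≤⇒0≤- h) (≤-respʳ-≈
              (solve 3 (λ P Q w → P :* (Q :* Q :- w) := P :* Q :* Q :- P :* w) refl (P p₁ p₂) (Q p₁ p₂) (W b₁ * W a₁))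
              (0≤* (<⇒≤ 0<P) (≤⇒0≤- (*-mono-≤ (<⇒≤ (0<W F₀.0≤b)) (<⇒≤ (0<W F₁.0≤a)) (W≤Q F₀.b≤1) (W≤Q F₁.a≤1))))))

          0≤N₁ : 0# ≤ N₁
          0≤N₁ = 0≤N (<⇒≤ 0<p₁) (<⇒≤ 0<q₁) F₁.a≤1 (<⇒≤ (0<W F₀.0≤b)) F₀.0≤b

          0≤N₂ : 0# ≤ N₂
          0≤N₂ = 0≤N (<⇒≤ 0<p₂) (<⇒≤ 0<q₂) F₀.b≤1 (<⇒≤ (0<W F₁.0≤a)) F₁.0≤a

          odds : Q p₁ p₂ * (a * b) ≤ P p₁ p₂ * ((1# - a) * (1# - b))
          odds = ≤-cases (Q p₁ p₂ * (a₁ * b₁)) (P p₁ p₂ * ((1# - a₁) * (1# - b₁))) >>= λ where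
            -- If `(a₁ , b₁)` already meets the odds constraint, so does the smaller pair `(a , b)`.
            (inj₁ small) → ≤-trans (*-mono-≤ (<⇒≤ 0<Q) (0≤* 0≤a 0≤b) (≤-reflexive refl) (*-mono-≤ 0≤a 0≤b a≤a₁ b≤b₁))
              (≤-trans small (*-mono-≤ (<⇒≤ 0<P) (0≤* (≤⇒0≤- F₁.a≤1) (≤⇒0≤- F₀.b≤1)) (≤-reflexive refl)
                (*-mono-≤ (≤⇒0≤- F₁.a≤1) (≤⇒0≤- F₀.b≤1) (1-‿anti a≤a₁) (1-‿anti b≤b₁))))
            -- Otherwise the section constraints are needed: scale by `W b₁ * W a₁` and pass through
            -- `M≤N`.
            (inj₂ large) → *-cancelˡ-≤ 0<WW
              (≤-respˡ-≈ (solve 5 (λ q a b v w → q :* ((a :* v) :* (b :* w)) := v :* w :* (q :* (a :* b)))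
                           refl (Q p₁ p₂) a b (W b₁) (W a₁))
              (≤-respʳ-≈ (solve 5 (λ q a b v w → q :* ((a :* v) :* (b :* w)) := v :* w :* (q :* (a :* b)))
                           refl (P p₁ p₂) (1# - a) (1# - b) (W b₁) (W a₁))
              (≤-trans (*-mono-≤ (<⇒≤ 0<Q) (0≤* 0≤aW 0≤bW) (≤-reflexive refl) (*-mono-≤ 0≤aW 0≤bW aW≤ bW≤))
              (≤-trans (M≤N (<⇒≤ large))
                (*-mono-≤ (<⇒≤ 0<P) (0≤* 0≤N₁ 0≤N₂) (≤-reflexive refl) (*-mono-≤ 0≤N₁ 0≤N₂ N₁≤ N₂≤))))))

      module Scaled (a₀≤ : Q p₁ p₂ * a₀ ≤ P p₁ p₂ * a₁) (b₀≤ : Q p₁ p₂ * b₀ ≤ P p₁ p₂ * b₁) where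
        x y : Carrier
        x = inverse 0<κ * a₀
        y = inverse 0<κ * b₀

        κ*scaled : ∀ z → κ * (inverse 0<κ * z) ≈ z
        κ*scaled z = trans (sym (*-assoc _ _ _)) (trans (*-congʳ (*-inverse 0<κ)) (*-identityˡ z))

        P*scaled : ∀ z → P p₁ p₂ * (inverse 0<κ * z) ≈ Q p₁ p₂ * z
        P*scaled z = trans (*-congʳ (sym Qκ≈P)) (trans (*-assoc _ _ _) (*-congˡ (κ*scaled z)))

        0≤x : 0# ≤ x
        0≤x = 0≤* (<⇒≤ (0<inverse 0<κ)) F₀.0≤a

        0≤y : 0# ≤ y
        0≤y = 0≤* (<⇒≤ (0<inverse 0<κ)) F₁.0≤b

        x≤a₁ : x ≤ a₁
        x≤a₁ = *-cancelˡ-≤ 0<P (≤-respˡ-≈ (sym (P*scaled a₀)) a₀≤)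

        y≤b₁ : y ≤ b₁
        y≤b₁ = *-cancelˡ-≤ 0<P (≤-respˡ-≈ (sym (P*scaled b₀)) b₀≤)

        -- The odds constraint divided by `P`, with `z` written as `κ` times its scaled value, and
        -- solved for `u`.
        cap : ∀ {u z} → Q p₁ p₂ * (u * z) ≤ P p₁ p₂ * ((1# - u) * (1# - z)) →
              u * (1# + (1# - κ) * (inverse 0<κ * z)) ≤ 1# - κ * (inverse 0<κ * z)
        cap {u} {z} h = ≤-from
          (solve 3 (λ k w u → :1 :- k :* w :- u :* (:1 :+ (:1 :- k) :* w)
                     := (:1 :- u) :* (:1 :- k :* w) :- u :* w) refl κ (inverse 0<κ * z) u)
          (≤⇒0≤- (*-cancelˡ-≤ 0<P
            (≤-respˡ-≈ (trans (solve 3 (λ q u z → q :* (u :* z) := u :* (q :* z)) refl (Q p₁ p₂) u z)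
                       (trans (*-congˡ (sym (P*scaled z)))
                              (solve 3 (λ p u w → u :* (p :* w) := p :* (u :* w)) refl (P p₁ p₂) u (inverse 0<κ * z))))
            (≤-respʳ-≈ (*-congˡ (*-congˡ (+-congˡ (-‿cong (sym (κ*scaled z)))))) h))))

        factor : ∀ {p q r u z t} → q * r ≈ p → z ≈ r * t → p * u + q * z ≈ p * (u + t)
        factor {p} {q} {r} {u} {z} {t} qr≈p z≈rt =
          trans (+-congˡ (trans (*-congˡ z≈rt) (trans (sym (*-assoc q r t)) (*-congʳ qr≈p)))) (sym (distribˡ p u t))

        -- Since `(1 - p₁) * α ≈ p₁`, the lower section `a₀ ≈ κ * x` contributes `p₁ * β * x`;
        -- likewise for `b₀`.
        ab≈PE : a * b ≈ P p₁ p₂ * ((a₁ + β * x) * (b₁ + α * y))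
        ab≈PE = trans
          (*-cong (factor (ratio 0<q₁) (trans (sym (κ*scaled a₀)) (*-assoc α β x)))
                  (factor (ratio 0<q₂) (trans (sym (κ*scaled b₀)) (trans (*-congʳ (*-comm α β)) (*-assoc β α y)))))
          (solve 4 (λ p q u v → p :* u :* (q :* v) := p :* q :* (u :* v)) refl p₁ p₂ (a₁ + β * x) (b₁ + α * y))

        cap₁ : a₁ * (1# + (1# - κ) * y) ≤ 1# - κ * y
        cap₁ = cap F₁.odds≤

        cap₂ : b₁ * (1# + (1# - κ) * x) ≤ 1# - κ * x
        cap₂ = cap (≤-respˡ-≈ (*-congˡ (*-comm _ _)) (≤-respʳ-≈ (*-congˡ (*-comm _ _)) F₀.odds≤))

        bound : a * b ≤ P p₁ p₂
        bound = ≤-respˡ-≈ (sym ab≈PE) (≤-respʳ-≈ (*-identityʳ _)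
          (*-mono-≤ (<⇒≤ 0<P)
             (0≤* (0≤+ F₁.0≤a (0≤* (<⇒≤ 0<β) 0≤x)) (0≤+ F₀.0≤b (0≤* (<⇒≤ 0<α) 0≤y)))
             (≤-reflexive refl)
             (mixed-bound refl 0<κ κ≤1 (<⇒≤ 0<α) α≤1 (<⇒≤ 0<β) β≤1 0≤x 0≤y
                x≤a₁ F₁.a≤1 y≤b₁ F₀.b≤1 cap₁ cap₂)))

        equality : κ < 1# → a * b ≈ P p₁ p₂ → ¬ ¬ (a₁ ≈ 1# × b₁ ≈ 1# × a₀ ≈ 0# × b₀ ≈ 0#)
        equality κ<1 e =
          mixed-equality refl 0<κ κ≤1 (<⇒≤ 0<α) α≤1 (<⇒≤ 0<β) β≤1 0≤x 0≤y
            x≤a₁ F₁.a≤1 y≤b₁ F₀.b≤1 cap₁ cap₂ κ<1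
            (*-cancelˡ 0<P (trans (sym ab≈PE) (trans e (sym (*-identityʳ _))))) >>= λ (x≈0 , y≈0 , a₁≈1 , b₁≈1) →
          return (a₁≈1 , b₁≈1 , *≈0⇒≈0 (0<inverse 0<κ) x≈0 , *≈0⇒≈0 (0<inverse 0<κ) y≈0)

      private
        swapX : b₁ * a₀ ≤ P p₂ p₁
        swapX = ≤-respˡ-≈ (*-comm _ _) (≤-respʳ-≈ (*-comm _ _) F₀.product≤)

        swapY : b₀ * a₁ ≤ P p₂ p₁
        swapY = ≤-respˡ-≈ (*-comm _ _) (≤-respʳ-≈ (*-comm _ _) F₁.product≤)

        swapH : P p₁ p₂ * b₁ < Q p₁ p₂ * b₀ → P p₂ p₁ * b₁ < Q p₂ p₁ * b₀
        swapH h = <-respˡ-≈ (*-congʳ (*-comm _ _)) (<-respʳ-≈ (*-congʳ (*-comm _ _)) h)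

      product : a * b ≤ P p₁ p₂
      product = ≤-cases (Q p₁ p₂ * a₀) (P p₁ p₂ * a₁) >>= λ where
        (inj₂ h)   → Cross.bound 0<p₁ 0<p₂ 0<q₁ 0<q₂ F₁.product≤ F₀.product≤ b₀≤b₁ h
        (inj₁ a₀≤) → ≤-cases (Q p₁ p₂ * b₀) (P p₁ p₂ * b₁) >>= λ where
          -- The same argument with the two families exchanged.
          (inj₂ h)   → ≤-respˡ-≈ (*-comm _ _) (≤-respʳ-≈ (*-comm _ _)
                         (Cross.bound 0<p₂ 0<p₁ 0<q₂ 0<q₁ swapX swapY a₀≤a₁ (swapH h)))
          (inj₁ b₀≤) → Scaled.bound a₀≤ b₀≤

      mix-feasible : Feasible p₁ p₂ (mix p₁ a₁ a₀) (mix p₂ b₁ b₀)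
      mix-feasible = record
        { 0≤a      = 0≤a
        ; a≤1      = mix≤1 (<⇒≤ 0<p₁) p₁≤1 F₁.a≤1 F₀.a≤1
        ; 0≤b      = 0≤b
        ; b≤1      = mix≤1 (<⇒≤ 0<p₂) p₂≤1 F₀.b≤1 F₁.b≤1
        ; product≤ = product
        ; odds≤    = Odds.odds
        }

      mix-equality : κ < 1# → mix p₁ a₁ a₀ * mix p₂ b₁ b₀ ≈ P p₁ p₂ →
                     ¬ ¬ ((a₁ ≈ a₀ × b₁ ≈ b₀) ⊎ (a₁ ≈ 1# × b₁ ≈ 1# × a₀ ≈ 0# × b₀ ≈ 0#))
      mix-equality κ<1 e = ≤-cases (Q p₁ p₂ * a₀) (P p₁ p₂ * a₁) >>= λ where
        (inj₂ h)   → return (inj₁ (Cross.equality 0<p₁ 0<p₂ 0<q₁ 0<q₂ F₁.product≤ F₀.product≤ b₀≤b₁ h e))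
        (inj₁ a₀≤) → ≤-cases (Q p₁ p₂ * b₀) (P p₁ p₂ * b₁) >>= λ where
          (inj₂ h)   → let b₁≈b₀ , a₁≈a₀ = Cross.equality 0<p₂ 0<p₁ 0<q₂ 0<q₁ swapX swapY a₀≤a₁ (swapH h)
                                              (trans (*-comm _ _) (trans e (*-comm _ _)))
                       in return (inj₁ (a₁≈a₀ , b₁≈b₀))
          (inj₁ b₀≤) → Scaled.equality a₀≤ b₀≤ κ<1 e >>= λ t → return (inj₂ t)

-- Boolean families, their sections and cross-intersection.

-- Boolean values make sections and unions compute and keep pointwise equality of families
-- decidable, hence stable.
Family : ℕ → Set
Family n = Subset n → Bool

infix 8 _⁺ _⁻
infixr 6 _∪ᶠ_
infix 4 _⊑_

_⁺ _⁻ : Family (suc n) → Family n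
f ⁺ = f ∘ (inside ∷_)
f ⁻ = f ∘ (outside ∷_)

_∪ᶠ_ : Family n → Family n → Family n
(f ∪ᶠ g) x = f x ∨ g x

_⊑_ : Family n → Family n → Set
f ⊑ g = ∀ x → f x ≡ true → g x ≡ true

star : Fin n → Family n
star ℓ x = lookup x ℓ

Cross : Family n → Family n → Set
Cross f g = ∀ {x y} → f x ≡ true → g y ≡ true → Nonempty (x ∩ y)

⊑-∪ˡ : (f g : Family n) → f ⊑ f ∪ᶠ g
⊑-∪ˡ f g x fx rewrite fx = ≡.refl

⊑-∪ʳ : (f g : Family n) → g ⊑ f ∪ᶠ g
⊑-∪ʳ f g x gx rewrite gx = Bool.∨-zeroʳ (f x)

⊑∧false⇒false : {f g : Family n} → f ⊑ g → g ≗ const false → f ≗ const false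
⊑∧false⇒false {f = f} f⊑g g≗false x with f x in fx
... | false = ≡.refl
... | true  = contradiction (≡.trans (≡.sym (g≗false x)) (f⊑g x fx)) λ ()

glue : {f g : Family (suc n)} → f ⁺ ≗ g ⁺ → f ⁻ ≗ g ⁻ → f ≗ g
glue f⁺≗g⁺ f⁻≗g⁻ (true  ∷ x) = f⁺≗g⁺ x
glue f⁺≗g⁺ f⁻≗g⁻ (false ∷ x) = f⁻≗g⁻ x

Cross-sym : {f g : Family n} → Cross f g → Cross g f
Cross-sym cross {x} {y} gx fy with cross fy gx
... | ℓ , ℓ∈ = ℓ , ∩-swap x y ℓ∈
  where
  ∩-swap : ∀ x y {ℓ} → ℓ ∈ y ∩ x → ℓ ∈ x ∩ y
  ∩-swap x y h rewrite ∩-comm x y = h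

-- The set from `g` omits the first coordinate, so the common element lies in the tail. For `f ⁺`
-- against `g ⁺` this would fail.
Cross-⁺⁻ : {f g : Family (suc n)} → Cross f g → Cross (f ⁺) (g ⁻)
Cross-⁺⁻ cross fx gy with cross fx gy
... | suc ℓ , there ℓ∈ = ℓ , ℓ∈

Cross-⁻⁻ : {f g : Family (suc n)} → Cross f g → Cross (f ⁻) (g ⁻)
Cross-⁻⁻ cross fx gy with cross fx gy
... | suc ℓ , there ℓ∈ = ℓ , ℓ∈

Cross-⁻⁺ : {f g : Family (suc n)} → Cross f g → Cross (f ⁻) (g ⁺)
Cross-⁻⁺ cross fx gy with cross fx gy
... | suc ℓ , there ℓ∈ = ℓ , ℓ∈

-- Both sections of `f` cross-intersect `g ⁻`, hence so does their union. This allows `f ⁺` to be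
-- enlarged to contain `f ⁻` before measures are compared.
Cross-∪⁻ : {f g : Family (suc n)} → Cross f g → Cross (f ⁺ ∪ᶠ f ⁻) (g ⁻)
Cross-∪⁻ {f = f} {g} cross {x} fx gy with f (inside ∷ x) in f⁺x
... | true  = Cross-⁺⁻ {f = f} {g} cross f⁺x gy
... | false = Cross-⁻⁻ {f = f} {g} cross fx gy

Cross-⁻∪ : {f g : Family (suc n)} → Cross f g → Cross (f ⁻) (g ⁺ ∪ᶠ g ⁻)
Cross-⁻∪ {f = f} {g} cross = Cross-sym {f = g ⁺ ∪ᶠ g ⁻} {f ⁻} (Cross-∪⁻ {f = g} {f} (Cross-sym {f = f} {g} cross))

-- The product measure, computed coordinate by coordinate.

module Measures {c ℓ₁ ℓ₂} (R : RealNumbers c ℓ₁ ℓ₂) where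
  open OrderedField R
  open MixedSections R
  open Regions R
  open ProductMeasure R using (IsProbabilityVector)

  -- The product measure by conditioning on the first coordinate, as the inductions need it; `μ≈ν`
  -- identifies it with `μ`.
  ν : Vector Carrier n → Family n → Carrier
  ν {zero}  p f = if f [] then 1# else 0#
  ν {suc n} p f = mix (p zero) (ν (p ∘ suc) (f ⁺)) (ν (p ∘ suc) (f ⁻))

  mix-cong : ∀ {p q a a′ b b′} → p ≈ q → a ≈ a′ → b ≈ b′ → mix p a b ≈ mix q a′ b′
  mix-cong p≈q a≈a′ b≈b′ = +-cong (*-cong p≈q a≈a′) (*-cong (+-congˡ (-‿cong p≈q)) b≈b′)

  mix-idem : ∀ p a → mix p a a ≈ a
  mix-idem p a = solve 2 (λ p a → p :* a :+ (:1 :- p) :* a := a) refl p a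

  mix-mono : ∀ {p a a′ b b′} → 0# ≤ p → p ≤ 1# → a ≤ a′ → b ≤ b′ → mix p a b ≤ mix p a′ b′
  mix-mono {p} {a} {a′} {b} {b′} 0≤p p≤1 a≤a′ b≤b′ =
    ≤-from (solve 5 (λ p a a′ b b′ → p :* a′ :+ (:1 :- p) :* b′ :- (p :* a :+ (:1 :- p) :* b)
                       := p :* (a′ :- a) :+ (:1 :- p) :* (b′ :- b)) refl p a a′ b b′)
      (0≤mix 0≤p p≤1 (≤⇒0≤- a≤a′) (≤⇒0≤- b≤b′))

  mix-mono-equality : ∀ {p a a′ b b′} → 0# < p → p < 1# → a ≤ a′ → b ≤ b′ →
                      mix p a b ≈ mix p a′ b′ → a ≈ a′ × b ≈ b′
  mix-mono-equality {p} {a} {a′} {b} {b′} 0<p p<1 a≤a′ b≤b′ e =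
      sym (-‿≈0⇒≈ (*≈0⇒≈0 0<p (0≤+≈0⇒≈0ˡ 0≤da 0≤db sum≈0)))
    , sym (-‿≈0⇒≈ (*≈0⇒≈0 (<⇒0<- p<1) (0≤+≈0⇒≈0ʳ 0≤da 0≤db sum≈0)))
    where
    0≤da : 0# ≤ p * (a′ - a)
    0≤da = 0≤* (<⇒≤ 0<p) (≤⇒0≤- a≤a′)

    0≤db : 0# ≤ (1# - p) * (b′ - b)
    0≤db = 0≤* (<⇒≤ (<⇒0<- p<1)) (≤⇒0≤- b≤b′)

    sum≈0 : p * (a′ - a) + (1# - p) * (b′ - b) ≈ 0#
    sum≈0 = trans (solve 5 (λ p a a′ b b′ → p :* (a′ :- a) :+ (:1 :- p) :* (b′ :- b)
                     := p :* a′ :+ (:1 :- p) :* b′ :- (p :* a :+ (:1 :- p) :* b)) refl p a a′ b b′)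
                  (≈⇒-‿≈0 (sym e))

  -- Separates the gain from enlarging the upper section from the gain from raising the probability,
  -- so that equality can be read off for each.
  raise : ∀ {s p a a′ b} → mix p a′ b - mix s a b ≈ s * (a′ - a) + (p - s) * (a′ - b)
  raise {s} {p} {a} {a′} {b} =
    solve 5 (λ s p a a′ b → p :* a′ :+ (:1 :- p) :* b :- (s :* a :+ (:1 :- s) :* b)
                              := s :* (a′ :- a) :+ (p :- s) :* (a′ :- b)) refl s p a a′ b

  mix-raise : ∀ {s p a a′ b} → 0# ≤ s → s ≤ p → a ≤ a′ → b ≤ a′ → mix s a b ≤ mix p a′ b
  mix-raise 0≤s s≤p a≤a′ b≤a′ = ≤-from raise (0≤+ (0≤* 0≤s (≤⇒0≤- a≤a′)) (0≤* (≤⇒0≤- s≤p) (≤⇒0≤- b≤a′)))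

  -- Both gains vanish. The first has the positive factor `s`; in the second either factor may be
  -- the one that is zero, and which one is known only under double negation.
  mix-raise-equality : ∀ {s p a a′ b} → 0# < s → s ≤ p → a ≤ a′ → b ≤ a′ →
                       mix s a b ≈ mix p a′ b → a ≈ a′ × ¬ ¬ (s ≈ p ⊎ a′ ≈ b)
  mix-raise-equality {s} {p} {a} {a′} {b} 0<s s≤p a≤a′ b≤a′ e =
      sym (-‿≈0⇒≈ (*≈0⇒≈0 0<s (0≤+≈0⇒≈0ˡ 0≤l 0≤r sum≈0)))
    , (≤-split s≤p >>= λ where
         (inj₁ s<p) → return (inj₂ (-‿≈0⇒≈ (*≈0⇒≈0 (<⇒0<- s<p) (0≤+≈0⇒≈0ʳ 0≤l 0≤r sum≈0))))
         (inj₂ s≈p) → return (inj₁ s≈p))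
    where
    0≤l : 0# ≤ s * (a′ - a)
    0≤l = 0≤* (<⇒≤ 0<s) (≤⇒0≤- a≤a′)

    0≤r : 0# ≤ (p - s) * (a′ - b)
    0≤r = 0≤* (≤⇒0≤- s≤p) (≤⇒0≤- b≤a′)

    sum≈0 : s * (a′ - a) + (p - s) * (a′ - b) ≈ 0#
    sum≈0 = trans (sym raise) (≈⇒-‿≈0 (sym e))

  mix-halves : ∀ {p a u v} → p + p ≈ 1# → a + a ≈ 1# → a ≈ mix p u v → u + v ≈ 1#
  mix-halves {p} {a} {u} {v} 2p≈1 2a≈1 a≈ = trans
    (solve 3 (λ p u v → u :+ v := (p :* u :+ (:1 :- p) :* v) :+ (p :* u :+ (:1 :- p) :* v)
                           :- (p :+ p :- :1) :* (u :- v)) refl p u v)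
    (trans (+-cong (trans (+-cong (sym a≈) (sym a≈)) 2a≈1) (-‿cong (*-zeroˡ′ (≈⇒-‿≈0 2p≈1))))
           (solve 0 (:1 :- :0 := :1) refl))

  +≈1∧≈1⇒≈0 : ∀ {x y} → x + y ≈ 1# → x ≈ 1# → y ≈ 0#
  +≈1∧≈1⇒≈0 {x} {y} h x≈1 = trans (solve 2 (λ x y → y := (x :+ y) :- x) refl x y)
    (trans (+-cong h (-‿cong x≈1)) (-‿inverseʳ 1#))

  +≈1∧≈0⇒≈1 : ∀ {x y} → x + y ≈ 1# → x ≈ 0# → y ≈ 1#
  +≈1∧≈0⇒≈1 h x≈0 = trans (sym (+-zeroˡ x≈0)) h

  ν-cong : (p : Vector Carrier n) {f g : Family n} → f ≗ g → ν p f ≈ ν p g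
  ν-cong {zero}  p {f} {g} f≗g with f [] | g [] | f≗g []
  ... | b | .b | ≡.refl = refl
  ν-cong {suc n} p f≗g = mix-cong refl (ν-cong (p ∘ suc) (f≗g ∘ (inside ∷_))) (ν-cong (p ∘ suc) (f≗g ∘ (outside ∷_)))

  ν-const : (p : Vector Carrier n) (b : Bool) → ν p (const b) ≈ (if b then 1# else 0#)
  ν-const {zero}  p b = refl
  ν-const {suc n} p b = trans (mix-cong refl (ν-const (p ∘ suc) b) (ν-const (p ∘ suc) b)) (mix-idem (p zero) _)

  ν-star : (p : Vector Carrier n) (ℓ : Fin n) → ν p (star ℓ) ≈ p ℓ
  ν-star p zero    = trans (mix-cong refl (ν-const (p ∘ suc) true) (ν-const (p ∘ suc) false))
                           (solve 1 (λ p → p :* :1 :+ (:1 :- p) :* :0 := p) refl (p zero))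
  ν-star p (suc ℓ) = trans (mix-idem (p zero) _) (ν-star (p ∘ suc) ℓ)

  tail : {p : Vector Carrier (suc n)} → IsProbabilityVector p → IsProbabilityVector (p ∘ suc)
  tail P ℓ = P (suc ℓ)

  ν-mono : {p : Vector Carrier n} → IsProbabilityVector p → {f g : Family n} → f ⊑ g → ν p f ≤ ν p g
  ν-mono {zero}  pv {f} {g} f⊑g with f [] | g [] | f⊑g []
  ... | false | false | _ = ≤-reflexive refl
  ... | false | true  | _ = 0≤1
  ... | true  | true  | _ = ≤-reflexive refl
  ... | true  | false | h = contradiction (h ≡.refl) λ ()
  ν-mono {suc n} pv f⊑g = mix-mono (<⇒≤ (proj₁ (pv zero))) (<⇒≤ (proj₂ (pv zero)))
    (ν-mono (tail pv) (f⊑g ∘ (inside ∷_))) (ν-mono (tail pv) (f⊑g ∘ (outside ∷_)))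

  -- All probabilities lie strictly between 0 and 1, so every set has positive weight and a proper
  -- inclusion raises the measure strictly.
  ν-mono-equality : {p : Vector Carrier n} → IsProbabilityVector p → {f g : Family n} →
                    f ⊑ g → ν p f ≈ ν p g → f ≗ g
  ν-mono-equality {zero} pv {f} {g} f⊑g e [] with f [] | g [] | f⊑g []
  ... | false | false | _ = ≡.refl
  ... | false | true  | _ = contradiction 0<1 (<-irrefl e)
  ... | true  | true  | _ = ≡.refl
  ... | true  | false | h = ≡.sym (h ≡.refl)
  ν-mono-equality {suc n} pv {f} {g} f⊑g e =
    glue (ν-mono-equality (tail pv) (f⊑g ∘ (inside ∷_)) (proj₁ split))
         (ν-mono-equality (tail pv) (f⊑g ∘ (outside ∷_)) (proj₂ split))
    where
    split = mix-mono-equality (proj₁ (pv zero)) (proj₂ (pv zero))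
              (ν-mono (tail pv) (f⊑g ∘ (inside ∷_))) (ν-mono (tail pv) (f⊑g ∘ (outside ∷_))) e

  module _ {p : Vector Carrier n} (pv : IsProbabilityVector p) {f : Family n} where
    0≤ν : 0# ≤ ν p f
    0≤ν = ≤-respˡ-≈ (ν-const p false) (ν-mono pv {const false} {f} λ _ ())

    ν≈0⇒false : ν p f ≈ 0# → f ≗ const false
    ν≈0⇒false e x = ≡.sym (ν-mono-equality pv {const false} {f} (λ _ ()) (trans (ν-const p false) (sym e)) x)

    ν≈1⇒true : ν p f ≈ 1# → f ≗ const true
    ν≈1⇒true e = ν-mono-equality pv {f} {const true} (λ _ _ → ≡.refl) (trans e (sym (ν-const p true)))

-- Counting coordinates and telling stars apart.

HasAtLeast-zero : ∀ {a} {A : Pred (Fin n) a} → HasAtLeast 0 A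
HasAtLeast-zero = mk↣ {to = λ ()} (λ { {()} }) , λ ()

HasAtLeast-suc : ∀ {a k} {A : Pred (Fin (suc n)) a} → HasAtLeast k (A ∘ suc) → HasAtLeast k A
HasAtLeast-suc (f , Af) = mk↣ {to = suc ∘ Injection.to f} (Injection.injective f ∘ suc-injective) , Af

HasAtLeast-∷ : ∀ {a k} {A : Pred (Fin (suc n)) a} → A zero → HasAtLeast k (A ∘ suc) → HasAtLeast (suc k) A
HasAtLeast-∷ {n = n} {k = k} {A = A} A0 (f , Af) = mk↣ {to = to} injective , holds
  where
  to : Fin (suc k) → Fin (suc n)
  to zero    = zero
  to (suc i) = suc (Injection.to f i)

  injective : ∀ {i j} → to i ≡ to j → i ≡ j
  injective {zero}  {zero}  _ = ≡.refl
  injective {suc i} {suc j} e = ≡.cong suc (Injection.injective f (suc-injective e))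

  holds : ∀ i → A (to i)
  holds zero    = A0
  holds (suc i) = Af i

⊥-∉star : (ℓ : Fin n) → star ℓ ⊥ ≡ false
⊥-∉star ℓ = lookup-replicate ℓ outside

⁅⁆-∈star : (ℓ : Fin n) → star ℓ ⁅ ℓ ⁆ ≡ true
⁅⁆-∈star zero    = ≡.refl
⁅⁆-∈star (suc ℓ) = ⁅⁆-∈star ℓ

-- The singleton of `ℓ` lies in the star of `ℓ` and in no other star.
star-⊑⇒≡ : {ℓ k : Fin n} → star ℓ ⊑ star k → ℓ ≡ k
star-⊑⇒≡ {ℓ = zero}  {zero}  h = ≡.refl
star-⊑⇒≡ {ℓ = zero}  {suc k} h = contradiction (≡.trans (≡.sym (⊥-∉star k)) (h (inside ∷ ⊥) ≡.refl)) λ ()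
star-⊑⇒≡ {ℓ = suc ℓ} {zero}  h = contradiction (h (outside ∷ ⁅ ℓ ⁆) (⁅⁆-∈star ℓ)) λ ()
star-⊑⇒≡ {ℓ = suc ℓ} {suc k} h = ≡.cong suc (star-⊑⇒≡ λ x → h (outside ∷ x))

-- Induction on coordinates: the bound and the extremal families.

module Extremal {c ℓ₁ ℓ₂} (R : RealNumbers c ℓ₁ ℓ₂) where
  open OrderedField R
  open MixedSections R
  open Regions R
  open Measures R
  open ProductMeasure R using (IsProbabilityVector)

  -- `p₁` and `p₂` are fixed upper bounds, not maxima: the region `Feasible` must stay the same when
  -- the induction passes to a tail in which no coordinate attains them.
  module Bounded (p₁ p₂ : Carrier) (0<p₁ : 0# < p₁) (0<p₂ : 0# < p₂)
                 (p₁≤q₁ : p₁ ≤ 1# - p₁) (p₂≤q₂ : p₂ ≤ 1# - p₂) where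
    open Step p₁ p₂ 0<p₁ 0<p₂ p₁≤q₁ p₂≤q₂

    private
      Feas : Carrier → Carrier → Set ℓ₂
      Feas = Feasible p₁ p₂

    feasible-corner : ∀ {a b} → 0# ≤ a → a ≤ 1# → 0# ≤ b → b ≤ 1# → a * b ≈ 0# → Feas a b
    feasible-corner 0≤a a≤1 0≤b b≤1 ab≈0 = record
      { 0≤a = 0≤a ; a≤1 = a≤1 ; 0≤b = 0≤b ; b≤1 = b≤1
      ; product≤ = ≤-respˡ-≈ (sym ab≈0) (<⇒≤ 0<P)
      ; odds≤    = ≤-respˡ-≈ (sym (*-zeroʳ′ ab≈0)) (0≤* (<⇒≤ 0<P) (0≤* (≤⇒0≤- a≤1) (≤⇒0≤- b≤1)))
      }

    feasible-down : ∀ {a a′ b b′} → 0# ≤ a → a ≤ a′ → 0# ≤ b → b ≤ b′ → Feas a′ b′ → Feas a b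
    feasible-down {a} {a′} {b} {b′} 0≤a a≤a′ 0≤b b≤b′ F = record
      { 0≤a = 0≤a ; a≤1 = ≤-trans a≤a′ F.a≤1 ; 0≤b = 0≤b ; b≤1 = ≤-trans b≤b′ F.b≤1
      ; product≤ = ≤-trans ab≤ F.product≤
      ; odds≤    = ≤-trans (*-mono-≤ (<⇒≤ 0<Q) (0≤* 0≤a 0≤b) (≤-reflexive refl) ab≤)
                  (≤-trans F.odds≤ (*-mono-≤ (<⇒≤ 0<P) (0≤* (≤⇒0≤- F.a≤1) (≤⇒0≤- F.b≤1)) (≤-reflexive refl)
                    (*-mono-≤ (≤⇒0≤- F.a≤1) (≤⇒0≤- F.b≤1) (1-‿anti a≤a′) (1-‿anti b≤b′))))
      }
      where
      module F = Feasible F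

      ab≤ : a * b ≤ a′ * b′
      ab≤ = *-mono-≤ 0≤a 0≤b a≤a′ b≤b′

    record Admissible (s t : Vector Carrier n) : Set ℓ₂ where
      field
        probability₁ : IsProbabilityVector s
        probability₂ : IsProbabilityVector t
        bounded₁     : ∀ ℓ → s ℓ ≤ p₁
        bounded₂     : ∀ ℓ → t ℓ ≤ p₂

    admissible-tail : {s t : Vector Carrier (suc n)} → Admissible s t → Admissible (s ∘ suc) (t ∘ suc)
    admissible-tail A = record
      { probability₁ = probability₁ ∘ suc ; probability₂ = probability₂ ∘ suc
      ; bounded₁ = bounded₁ ∘ suc ; bounded₂ = bounded₂ ∘ suc }
      where open Admissible A

    -- Stated before `Sections` because the two are mutually recursive: `Sections` applies it to the
    -- tails, and the inductive case mixes the resulting constraints and descends to the actual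
    -- measures.
    feasible : {s t : Vector Carrier n} → Admissible s t → {f g : Family n} → Cross f g → Feas (ν s f) (ν t g)

    module Sections {s t : Vector Carrier (suc n)} (A : Admissible s t) {f g : Family (suc n)} (cross : Cross f g) where
      open Admissible A

      a₁ a₀ b₁ b₀ : Carrier
      a₁ = ν (s ∘ suc) (f ⁺ ∪ᶠ f ⁻)
      a₀ = ν (s ∘ suc) (f ⁻)
      b₁ = ν (t ∘ suc) (g ⁺ ∪ᶠ g ⁻)
      b₀ = ν (t ∘ suc) (g ⁻)

      a⁺≤a₁ : ν (s ∘ suc) (f ⁺) ≤ a₁
      a⁺≤a₁ = ν-mono (tail probability₁) (⊑-∪ˡ (f ⁺) (f ⁻))

      b⁺≤b₁ : ν (t ∘ suc) (g ⁺) ≤ b₁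
      b⁺≤b₁ = ν-mono (tail probability₂) (⊑-∪ˡ (g ⁺) (g ⁻))

      a₀≤a₁ : a₀ ≤ a₁
      a₀≤a₁ = ν-mono (tail probability₁) (⊑-∪ʳ (f ⁺) (f ⁻))

      b₀≤b₁ : b₀ ≤ b₁
      b₀≤b₁ = ν-mono (tail probability₂) (⊑-∪ʳ (g ⁺) (g ⁻))

      F₁ : Feas a₁ b₀
      F₁ = feasible (admissible-tail A) (Cross-∪⁻ {f = f} {g} cross)

      F₀ : Feas a₀ b₁
      F₀ = feasible (admissible-tail A) (Cross-⁻∪ {f = f} {g} cross)

      mixed : Feas (mix p₁ a₁ a₀) (mix p₂ b₁ b₀)
      mixed = mix-feasible F₁ F₀ a₀≤a₁ b₀≤b₁

      a≤ : ν s f ≤ mix p₁ a₁ a₀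
      a≤ = mix-raise (<⇒≤ (proj₁ (probability₁ zero))) (bounded₁ zero) a⁺≤a₁ a₀≤a₁

      b≤ : ν t g ≤ mix p₂ b₁ b₀
      b≤ = mix-raise (<⇒≤ (proj₁ (probability₂ zero))) (bounded₂ zero) b⁺≤b₁ b₀≤b₁

      -- When the relaxation to `mix p₁ a₁ a₀` and `mix p₂ b₁ b₀` loses nothing, each upper section
      -- already contains the lower one, and each probability attains its bound unless the two
      -- sections have equal measure.
      module Attained (a≈ : ν s f ≈ mix p₁ a₁ a₀) (b≈ : ν t g ≈ mix p₂ b₁ b₀) where
        private
          raised₁ = mix-raise-equality (proj₁ (probability₁ zero)) (bounded₁ zero) a⁺≤a₁ a₀≤a₁ a≈
          raised₂ = mix-raise-equality (proj₁ (probability₂ zero)) (bounded₂ zero) b⁺≤b₁ b₀≤b₁ b≈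

        f⁺≗ : f ⁺ ≗ f ⁺ ∪ᶠ f ⁻
        f⁺≗ = ν-mono-equality (tail probability₁) (⊑-∪ˡ (f ⁺) (f ⁻)) (proj₁ raised₁)

        g⁺≗ : g ⁺ ≗ g ⁺ ∪ᶠ g ⁻
        g⁺≗ = ν-mono-equality (tail probability₂) (⊑-∪ˡ (g ⁺) (g ⁻)) (proj₁ raised₂)

        tight₁ : ¬ ¬ (s zero ≈ p₁ ⊎ a₁ ≈ a₀)
        tight₁ = proj₂ raised₁

        tight₂ : ¬ ¬ (t zero ≈ p₂ ⊎ b₁ ≈ b₀)
        tight₂ = proj₂ raised₂

        a₁≈a₀⇒ : a₁ ≈ a₀ → f ⁺ ≗ f ⁻
        a₁≈a₀⇒ e x = ≡.trans (f⁺≗ x)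
          (≡.sym (ν-mono-equality (tail probability₁) (⊑-∪ʳ (f ⁺) (f ⁻)) (sym e) x))

        b₁≈b₀⇒ : b₁ ≈ b₀ → g ⁺ ≗ g ⁻
        b₁≈b₀⇒ e x = ≡.trans (g⁺≗ x)
          (≡.sym (ν-mono-equality (tail probability₂) (⊑-∪ʳ (g ⁺) (g ⁻)) (sym e) x))

    feasible {zero} A {f} {g} cross with f [] in f[] | g [] in g[]
    -- Over no coordinates, both families would contain the empty set, which does not meet itself.
    ... | true  | true  with () ← proj₁ (cross f[] g[])
    ... | false | true  = feasible-corner (≤-reflexive refl) 0≤1 0≤1 (≤-reflexive refl) (zeroˡ _)
    ... | false | false = feasible-corner (≤-reflexive refl) 0≤1 (≤-reflexive refl) 0≤1 (zeroˡ _)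
    ... | true  | false = feasible-corner 0≤1 (≤-reflexive refl) (≤-reflexive refl) 0≤1 (zeroʳ _)
    feasible {suc n} A {f} {g} cross =
      feasible-down (0≤ν probability₁ {f}) a≤ (0≤ν probability₂ {g}) b≤ mixed
      where
      open Admissible A
      open Sections A {f} {g} cross

    Extreme : Vector Carrier n → Vector Carrier n → Pred (Fin n) ℓ₁
    Extreme s t ℓ = s ℓ ≈ p₁ × t ℓ ≈ p₂

    Dictator : Vector Carrier n → Vector Carrier n → Family n → Family n → Set ℓ₁
    Dictator s t f g = ∃[ ℓ ] (Extreme s t ℓ × f ≗ star ℓ × g ≗ star ℓ)

    dictator-here : {s t : Vector Carrier (suc n)} {f g : Family (suc n)} → Extreme s t zero →
                    f ⁺ ≗ const true → f ⁻ ≗ const false → g ⁺ ≗ const true → g ⁻ ≗ const false → Dictator s t f g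
    dictator-here ext f⁺ f⁻ g⁺ g⁻ = zero , ext , glue f⁺ f⁻ , glue g⁺ g⁻

    dictator-there : {s t : Vector Carrier (suc n)} {f g : Family (suc n)} → f ⁺ ≗ f ⁻ → g ⁺ ≗ g ⁻ →
                     Dictator (s ∘ suc) (t ∘ suc) (f ⁺) (g ⁻) → Dictator s t f g
    dictator-there f⁺≗f⁻ g⁺≗g⁻ (ℓ , ext , f⁺≗ , g⁻≗) =
      suc ℓ , ext , glue f⁺≗ (λ x → ≡.trans (≡.sym (f⁺≗f⁻ x)) (f⁺≗ x))
                  , glue (λ x → ≡.trans (g⁺≗g⁻ x) (g⁻≗ x)) g⁻≗

    module _ (κ<1 : κ < 1#) where
      dictator : {s t : Vector Carrier n} → Admissible s t → {f g : Family n} → Cross f g →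
                 ν s f * ν t g ≈ P p₁ p₂ → ¬ ¬ Dictator s t f g
      dictator {zero} A {f} {g} cross e with f [] in f[] | g [] in g[]
      ... | true  | true  with () ← proj₁ (cross f[] g[])
      ... | false | _     = contradiction (trans (sym e) (zeroˡ _)) (0<⇒≉0 0<P)
      ... | true  | false = contradiction (trans (sym e) (zeroʳ _)) (0<⇒≉0 0<P)
      dictator {suc n} {s} {t} A {f} {g} cross e =
        mix-equality F₁ F₀ a₀≤a₁ b₀≤b₁ κ<1 mixed≈ >>= λ where
          -- The first coordinate is irrelevant. `f ⁺` and `g ⁻` represent the families because such
          -- a pair inherits cross-intersection.
          (inj₁ (a₁≈a₀ , b₁≈b₀)) →
            dictator (admissible-tail A) {f ⁺} {g ⁻} (Cross-⁺⁻ {f = f} {g} cross)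
              (trans (*-cong (sym (a≈tail a₁≈a₀)) (sym (b≈tail b₁≈b₀))) e) >>= λ D →
            return (dictator-there (a₁≈a₀⇒ a₁≈a₀) (b₁≈b₀⇒ b₁≈b₀) D)
          (inj₂ (a₁≈1 , b₁≈1 , a₀≈0 , b₀≈0)) →
            -- Sections of measures 1 and 0 differ, so the first coordinate must attain both bounds.
            tight₁ >>= λ where
              (inj₂ a₁≈a₀) → contradiction (trans (sym a₁≈1) (trans a₁≈a₀ a₀≈0)) (0<⇒≉0 0<1)
              (inj₁ s≈p₁)  → tight₂ >>= λ where
                (inj₂ b₁≈b₀) → contradiction (trans (sym b₁≈1) (trans b₁≈b₀ b₀≈0)) (0<⇒≉0 0<1)
                (inj₁ t≈p₂)  → return (dictator-here (s≈p₁ , t≈p₂)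
                  (λ x → ≡.trans (f⁺≗ x) (ν≈1⇒true (tail probability₁) {f ⁺ ∪ᶠ f ⁻} a₁≈1 x))
                  (ν≈0⇒false (tail probability₁) {f ⁻} a₀≈0)
                  (λ x → ≡.trans (g⁺≗ x) (ν≈1⇒true (tail probability₂) {g ⁺ ∪ᶠ g ⁻} b₁≈1 x))
                  (ν≈0⇒false (tail probability₂) {g ⁻} b₀≈0))
        where
        open Admissible A
        open Sections A {f} {g} cross

        attained : ν s f ≈ mix p₁ a₁ a₀ × ν t g ≈ mix p₂ b₁ b₀
        attained = *-mono-equality (0≤ν probability₁ {f}) (0≤ν probability₂ {g}) a≤ b≤ (<-respʳ-≈ (sym e) 0<P)
          (≤-respʳ-≈ (sym e) (Feasible.product≤ mixed))

        mixed≈ : mix p₁ a₁ a₀ * mix p₂ b₁ b₀ ≈ P p₁ p₂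
        mixed≈ = trans (*-cong (sym (proj₁ attained)) (sym (proj₂ attained))) e

        open Attained (proj₁ attained) (proj₂ attained)

        a≈tail : a₁ ≈ a₀ → ν s f ≈ ν (s ∘ suc) (f ⁺)
        a≈tail a₁≈a₀ = trans (mix-cong refl refl (ν-cong (s ∘ suc) (λ x → ≡.sym (a₁≈a₀⇒ a₁≈a₀ x)))) (mix-idem (s zero) _)

        b≈tail : b₁ ≈ b₀ → ν t g ≈ ν (t ∘ suc) (g ⁻)
        b≈tail b₁≈b₀ = trans (mix-cong refl (ν-cong (t ∘ suc) (b₁≈b₀⇒ b₁≈b₀)) refl) (mix-idem (t zero) _)

    -- The solutions of `a + b ≈ 1` that depend on no coordinate.
    Trivial : Family n → Family n → Set
    Trivial f g = (f ≗ const true × g ≗ const false) ⊎ (f ≗ const false × g ≗ const true)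

    trivial-glue : {f g : Family (suc n)} → f ⁺ ≗ f ⁻ → g ⁺ ≗ g ⁻ → Trivial (f ⁺) (g ⁻) → Trivial f g
    trivial-glue f⁺≗f⁻ g⁺≗g⁻ = [ (λ (ft , gf) → inj₁ (glue ft (λ x → ≡.trans (≡.sym (f⁺≗f⁻ x)) (ft x)) , glue (λ x → ≡.trans (g⁺≗g⁻ x) (gf x)) gf))
                               , (λ (ff , gt) → inj₂ (glue ff (λ x → ≡.trans (≡.sym (f⁺≗f⁻ x)) (ff x)) , glue (λ x → ≡.trans (g⁺≗g⁻ x) (gt x)) gt)) ]′

    true-⊑ : {f g : Family n} → f ⊑ g → f ≗ const true → g ≗ const true
    true-⊑ f⊑g ft x = f⊑g x (ft x)

    true≗false-absurd : {f : Family n} → f ≗ const true → ¬ f ≗ const false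
    true≗false-absurd ft ff with () ← ≡.trans (≡.sym (ft ⊥)) (ff ⊥)

    -- For p₁ ≈ p₂ ≈ ½ the equality a * b ≈ P is weakened to a + b ≈ 1, which passes to both pairs of
    -- sections; the number of extreme coordinates then controls how many solutions there are.
    module Half (p₁≈q₁ : p₁ ≈ 1# - p₁) (p₂≈q₂ : p₂ ≈ 1# - p₂) where
      -- Here `P ≈ Q` cancels from the odds constraint, and `a * b ≤ (1 - a) * (1 - b)` is linear
      -- after expansion.
      sum≤1 : ∀ {a b} → Feas a b → a + b ≤ 1#
      sum≤1 {a} {b} F = ≤-from
        (solve 2 (λ a b → :1 :- (a :+ b) := (:1 :- a) :* (:1 :- b) :- a :* b) refl a b)
        (≤⇒0≤- (*-cancelˡ-≤ 0<Q (≤-respʳ-≈ (*-congʳ (*-cong p₁≈q₁ p₂≈q₂)) (Feasible.odds≤ F))))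

      p₁+p₁≈1 : p₁ + p₁ ≈ 1#
      p₁+p₁≈1 = trans (+-congˡ p₁≈q₁) (solve 1 (λ p → p :+ (:1 :- p) := :1) refl p₁)

      p₂≈1-p₁ : p₂ ≈ 1# - p₁
      p₂≈1-p₁ = *-cancelˡ 0<2 (trans (solve 1 (λ p → (:1 :+ :1) :* p := p :+ p) refl p₂)
        (trans (trans (+-congˡ p₂≈q₂) (solve 2 (λ p q → p :+ (:1 :- p) := (q :+ (:1 :- q))) refl p₂ p₁))
        (trans (+-congʳ p₁≈q₁) (solve 1 (λ p → p :+ p := (:1 :+ :1) :* p) refl (1# - p₁)))))

      module HalfSections {s t : Vector Carrier (suc n)} (A : Admissible s t) {f g : Family (suc n)}
                          (cross : Cross f g) (sum≈1 : ν s f + ν t g ≈ 1#) where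
        open Admissible A
        open Sections A {f} {g} cross

        private
          a≈ : ν s f ≈ mix p₁ a₁ a₀
          a≈ = sym (-‿≈0⇒≈ (0≤+≈0⇒≈0ˡ (≤⇒0≤- a≤) (≤⇒0≤- b≤) (≤-antisym
            (≤-from (trans (solve 4 (λ a a′ b b′ → :0 :- (a′ :- a :+ (b′ :- b)) := (a :+ b) :- (a′ :+ b′)) refl _ _ _ _)
                           (+-congʳ sum≈1)) (≤⇒0≤- (sum≤1 mixed)))
            (0≤+ (≤⇒0≤- a≤) (≤⇒0≤- b≤)))))

          b≈ : ν t g ≈ mix p₂ b₁ b₀
          b≈ = sym (-‿≈0⇒≈ (0≤+≈0⇒≈0ʳ (≤⇒0≤- a≤) (≤⇒0≤- b≤) (≤-antisym
            (≤-from (trans (solve 4 (λ a a′ b b′ → :0 :- (a′ :- a :+ (b′ :- b)) := (a :+ b) :- (a′ :+ b′)) refl _ _ _ _)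
                           (+-congʳ sum≈1)) (≤⇒0≤- (sum≤1 mixed)))
            (0≤+ (≤⇒0≤- a≤) (≤⇒0≤- b≤)))))

          open Attained a≈ b≈

          -- Because `p₂ ≈ 1 - p₁`, the weight of `a₁` equals that of `b₀`, and the weight of `a₀`
          -- that of `b₁`. So `a + b` is a weighted mean of two sums that are at most 1, and its
          -- value 1 forces both to be 1.
          mix-sum : mix p₁ (a₁ + b₀) (a₀ + b₁) ≈ mix p₁ 1# 1#
          mix-sum = trans
            (solve 5 (λ p a₁ a₀ b₁ b₀ → p :* (a₁ :+ b₀) :+ (:1 :- p) :* (a₀ :+ b₁)
               := (p :* a₁ :+ (:1 :- p) :* a₀) :+ ((:1 :- p) :* b₁ :+ (:1 :- (:1 :- p)) :* b₀)) refl p₁ a₁ a₀ b₁ b₀)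
            (trans (+-cong (sym a≈) (trans (mix-cong (sym p₂≈1-p₁) refl refl) (sym b≈)))
            (trans sum≈1 (sym (mix-idem p₁ 1#))))

          sums : a₁ + b₀ ≈ 1# × a₀ + b₁ ≈ 1#
          sums = mix-mono-equality 0<p₁ (0<-⇒< 0<q₁) (sum≤1 F₁) (sum≤1 F₀) mix-sum

        f⁻⊑f⁺ : f ⁻ ⊑ f ⁺
        f⁻⊑f⁺ x fx = ≡.trans (f⁺≗ x) (⊑-∪ʳ (f ⁺) (f ⁻) x fx)

        sum₁ : ν (s ∘ suc) (f ⁺) + ν (t ∘ suc) (g ⁻) ≈ 1#
        sum₁ = trans (+-congʳ (ν-cong (s ∘ suc) f⁺≗)) (proj₁ sums)

        sum₀ : ν (s ∘ suc) (f ⁻) + ν (t ∘ suc) (g ⁺) ≈ 1#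
        sum₀ = trans (+-congˡ (ν-cong (t ∘ suc) g⁺≗)) (proj₂ sums)

        mean : ν s f ≈ mix p₁ (ν (s ∘ suc) (f ⁺)) (ν (s ∘ suc) (f ⁻))
        mean = trans a≈ (mix-cong refl (sym (ν-cong (s ∘ suc) f⁺≗)) refl)

        cross₁ : Cross (f ⁺) (g ⁻)
        cross₁ = Cross-⁺⁻ {f = f} {g} cross

        cross₀ : Cross (f ⁻) (g ⁺)
        cross₀ = Cross-⁻⁺ {f = f} {g} cross

        private
          a₁-a₀≈b₁-b₀ : a₁ - a₀ ≈ b₁ - b₀
          a₁-a₀≈b₁-b₀ = trans (solve 3 (λ a₁ a₀ b₀ → a₁ :- a₀ := (a₁ :+ b₀) :- a₀ :- b₀) refl a₁ a₀ b₀)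
            (trans (+-congʳ (+-congʳ (trans (proj₁ sums) (sym (proj₂ sums)))))
                   (solve 3 (λ a₀ b₁ b₀ → (a₀ :+ b₁) :- a₀ :- b₀ := b₁ :- b₀) refl a₀ b₁ b₀))

        -- By `a₁ - a₀ ≈ b₁ - b₀`, a coordinate irrelevant to one family is irrelevant to the other.
        extreme-or-independent : ¬ ¬ (Extreme s t zero ⊎ (f ⁺ ≗ f ⁻ × g ⁺ ≗ g ⁻))
        extreme-or-independent = tight₁ >>= λ where
          (inj₂ a₁≈a₀) → return (inj₂ (a₁≈a₀⇒ a₁≈a₀ , b₁≈b₀⇒ (-‿≈0⇒≈ (trans (sym a₁-a₀≈b₁-b₀) (≈⇒-‿≈0 a₁≈a₀)))))
          (inj₁ s≈p₁)  → tight₂ >>= λ where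
            (inj₂ b₁≈b₀) → return (inj₂ (a₁≈a₀⇒ (-‿≈0⇒≈ (trans a₁-a₀≈b₁-b₀ (≈⇒-‿≈0 b₁≈b₀))) , b₁≈b₀⇒ b₁≈b₀))
            (inj₁ t≈p₂)  → return (inj₁ (s≈p₁ , t≈p₂))

      trivial-empty : {s t : Vector Carrier 0} {f g : Family 0} → Cross f g → ν s f + ν t g ≈ 1# → Trivial f g
      trivial-empty {f = f} {g} cross e with f [] in f[] | g [] in g[]
      ... | true  | true  with () ← proj₁ (cross f[] g[])
      ... | true  | false = inj₁ ((λ { [] → f[] }) , (λ { [] → g[] }))
      ... | false | true  = inj₂ ((λ { [] → f[] }) , (λ { [] → g[] }))
      ... | false | false = contradiction 0<1 (<-irrefl (trans (sym (+-identityˡ 0#)) e))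

      trivial : {s t : Vector Carrier n} → Admissible s t → {f g : Family n} → Cross f g → ν s f + ν t g ≈ 1# →
                ¬ HasAtLeast 1 (Extreme s t) → ¬ ¬ Trivial f g
      trivial {zero}  {s} {t} A {f} {g} cross e few = return (trivial-empty {s} {t} {f} {g} cross e)
      trivial {suc n} {s} {t} A {f} {g} cross e few = extreme-or-independent >>= λ where
          (inj₁ ext) → contradiction (HasAtLeast-∷ {A = Extreme s t} ext (HasAtLeast-zero {A = Extreme s t ∘ suc})) few
          (inj₂ (f⁺≗f⁻ , g⁺≗g⁻)) →
            trivial (admissible-tail A) {f ⁺} {g ⁻} cross₁ sum₁ (few ∘ HasAtLeast-suc {A = Extreme s t}) >>= λ T →
            return (trivial-glue {f = f} {g} f⁺≗f⁻ g⁺≗g⁻ T)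
        where open HalfSections A {f} {g} cross e

      -- An extreme first coordinate uses up the only one allowed, so both pairs of sections are
      -- trivial; otherwise the first coordinate is dropped.
      trivial-or-dictator : {s t : Vector Carrier n} → Admissible s t → {f g : Family n} → Cross f g → ν s f + ν t g ≈ 1# →
                            ¬ HasAtLeast 2 (Extreme s t) → ¬ ¬ (Trivial f g ⊎ Dictator s t f g)
      trivial-or-dictator {zero}  {s} {t} A {f} {g} cross e few = return (inj₁ (trivial-empty {s} {t} {f} {g} cross e))
      trivial-or-dictator {suc n} {s} {t} A {f} {g} cross e few = extreme-or-independent >>= λ where
          (inj₁ ext) →
            trivial (admissible-tail A) {f ⁺} {g ⁻} cross₁ sum₁ (few ∘ HasAtLeast-∷ {A = Extreme s t} ext) >>= λ T₁ →
            trivial (admissible-tail A) {f ⁻} {g ⁺} cross₀ sum₀ (few ∘ HasAtLeast-∷ {A = Extreme s t} ext) >>= λ T₀ →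
            combine ext T₁ T₀
          (inj₂ (f⁺≗f⁻ , g⁺≗g⁻)) →
            trivial-or-dictator (admissible-tail A) {f ⁺} {g ⁻} cross₁ sum₁ (few ∘ HasAtLeast-suc {A = Extreme s t}) >>= λ where
              (inj₁ T) → return (inj₁ (trivial-glue {f = f} {g} f⁺≗f⁻ g⁺≗g⁻ T))
              (inj₂ D) → return (inj₂ (dictator-there {f = f} {g} f⁺≗f⁻ g⁺≗g⁻ D))
        where
        open HalfSections A {f} {g} cross e

        combine : Extreme s t zero → Trivial (f ⁺) (g ⁻) → Trivial (f ⁻) (g ⁺) → ¬ ¬ (Trivial f g ⊎ Dictator s t f g)
        combine ext (inj₁ (f⁺t , g⁻f)) (inj₁ (f⁻t , g⁺f)) = return (inj₁ (inj₁ (glue f⁺t f⁻t , glue g⁺f g⁻f)))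
        combine ext (inj₁ (f⁺t , g⁻f)) (inj₂ (f⁻f , g⁺t)) = return (inj₂ (dictator-here {f = f} {g} ext f⁺t f⁻f g⁺t g⁻f))
        -- An empty upper section cannot contain a full lower one.
        combine ext (inj₂ (f⁺f , g⁻t)) (inj₁ (f⁻t , g⁺f)) = contradiction f⁺f (true≗false-absurd (true-⊑ f⁻⊑f⁺ f⁻t))
        combine ext (inj₂ (f⁺f , g⁻t)) (inj₂ (f⁻f , g⁺t)) = return (inj₁ (inj₂ (glue f⁺f f⁻f , glue g⁺t g⁻t)))

      -- The condition `a + a ≈ 1` excludes the trivial solutions. After an extreme first coordinate
      -- at most one remains for the sections. With three extreme coordinates the majority family
      -- would be a further solution, its sections being the union and the intersection of two
      -- stars.
      half-dictator : {s t : Vector Carrier n} → Admissible s t → {f g : Family n} → Cross f g → ν s f + ν t g ≈ 1# →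
                      ν s f + ν s f ≈ 1# → ¬ HasAtLeast 3 (Extreme s t) → ¬ ¬ Dictator s t f g
      half-dictator {zero} {s} A {f} cross e e′ few with f []
      ... | true  = contradiction (trans (solve 0 (:1 := (:1 :+ :1) :- :1) refl) (≈⇒-‿≈0 e′)) (0<⇒≉0 0<1)
      ... | false = contradiction 0<1 (<-irrefl (trans (sym (+-identityˡ 0#)) e′))
      half-dictator {suc n} {s} {t} A {f} {g} cross e e′ few = extreme-or-independent >>= λ where
          (inj₁ ext) →
            trivial-or-dictator (admissible-tail A) {f ⁺} {g ⁻} cross₁ sum₁ (few ∘ HasAtLeast-∷ {A = Extreme s t} ext) >>= λ C₁ →
            trivial-or-dictator (admissible-tail A) {f ⁻} {g ⁺} cross₀ sum₀ (few ∘ HasAtLeast-∷ {A = Extreme s t} ext) >>= λ C₀ →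
            combine ext C₁ C₀
          (inj₂ (f⁺≗f⁻ , g⁺≗g⁻)) →
            half-dictator (admissible-tail A) {f ⁺} {g ⁻} cross₁ sum₁ (halved f⁺≗f⁻) (few ∘ HasAtLeast-suc {A = Extreme s t}) >>= λ D →
            return (dictator-there {f = f} {g} f⁺≗f⁻ g⁺≗g⁻ D)
        where
        open Admissible A
        open HalfSections A {f} {g} cross e

        halves : ν (s ∘ suc) (f ⁺) + ν (s ∘ suc) (f ⁻) ≈ 1#
        halves = mix-halves p₁+p₁≈1 e′ mean

        halved : f ⁺ ≗ f ⁻ → ν (s ∘ suc) (f ⁺) + ν (s ∘ suc) (f ⁺) ≈ 1#
        halved f⁺≗f⁻ = trans (+-congˡ (ν-cong (s ∘ suc) f⁺≗f⁻)) halves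

        f⁺true⇒f⁻false : f ⁺ ≗ const true → ν (s ∘ suc) (f ⁻) ≈ 0#
        f⁺true⇒f⁻false f⁺t = +≈1∧≈1⇒≈0 halves (trans (ν-cong (s ∘ suc) f⁺t) (ν-const (s ∘ suc) true))

        f⁻false⇒f⁺true : f ⁻ ≗ const false → f ⁺ ≗ const true
        f⁻false⇒f⁺true f⁻f = ν≈1⇒true (tail probability₁) {f ⁺}
          (+≈1∧≈0⇒≈1 (trans (+-comm _ _) halves) (trans (ν-cong (s ∘ suc) f⁻f) (ν-const (s ∘ suc) false)))

        star-not-true : ∀ {ℓ} → f ⁺ ≗ star ℓ → ¬ f ⁺ ≗ const true
        star-not-true {ℓ} f⁺ℓ f⁺t with () ← ≡.trans (≡.sym (⊥-∉star ℓ)) (≡.trans (≡.sym (f⁺ℓ ⊥)) (f⁺t ⊥))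

        combine : Extreme s t zero → Trivial (f ⁺) (g ⁻) ⊎ Dictator (s ∘ suc) (t ∘ suc) (f ⁺) (g ⁻) →
                  Trivial (f ⁻) (g ⁺) ⊎ Dictator (s ∘ suc) (t ∘ suc) (f ⁻) (g ⁺) → ¬ ¬ Dictator s t f g
        combine ext (inj₁ (inj₁ (f⁺t , g⁻f))) _ = return (dictator-here {f = f} {g} ext f⁺t
          (ν≈0⇒false (tail probability₁) {f ⁻} (f⁺true⇒f⁻false f⁺t))
          (ν≈1⇒true (tail probability₂) {g ⁺} (+≈1∧≈0⇒≈1 sum₀ (f⁺true⇒f⁻false f⁺t))) g⁻f)
        combine ext (inj₁ (inj₂ (f⁺f , g⁻t))) _ =
          contradiction f⁺f (true≗false-absurd (f⁻false⇒f⁺true (⊑∧false⇒false f⁻⊑f⁺ f⁺f)))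
        combine ext (inj₂ (ℓ , _ , f⁺ℓ , _)) (inj₁ (inj₁ (f⁻t , _))) = contradiction (true-⊑ f⁻⊑f⁺ f⁻t) (star-not-true f⁺ℓ)
        combine ext (inj₂ (ℓ , _ , f⁺ℓ , _)) (inj₁ (inj₂ (f⁻f , _))) = contradiction (f⁻false⇒f⁺true f⁻f) (star-not-true f⁺ℓ)
        -- Since `f ⁻` lies in `f ⁺`, the two stars coincide and the first coordinate is irrelevant
        -- after all.
        combine ext (inj₂ D@(ℓ , _ , f⁺ℓ , g⁻ℓ)) (inj₂ (k , _ , f⁻k , g⁺k)) =
          return (dictator-there {f = f} {g} (λ x → ≡.trans (f⁺ℓ x) (≡.sym (≡.trans (f⁻k x) (star≗ x))))
                                             (λ x → ≡.trans (g⁺k x) (≡.trans (star≗ x) (≡.sym (g⁻ℓ x)))) D)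
          where
          star≗ : star k ≗ star ℓ
          star≗ x = ≡.cong (lookup x) (star-⊑⇒≡ {ℓ = k} {ℓ} λ x xk →
            ≡.trans (≡.sym (f⁺ℓ x)) (f⁻⊑f⁺ x (≡.trans (f⁻k x) xk)))

-- Agreement of the two descriptions of the product measure.

module Bridge {c ℓ₁ ℓ₂} (R : RealNumbers c ℓ₁ ℓ₂) where
  open OrderedField R
  open Regions R
  open Measures R
  open ProductMeasure R

  select-suc : ∀ b (x : Subset n) (f : Vector Carrier (suc n)) (is : List (Fin n)) →
               map f (filter (_∈? (b ∷ x)) (map suc is)) ≡ map (f ∘ suc) (filter (_∈? x) is)
  select-suc b x f List.[]       = ≡.refl
  select-suc b x f (i List.∷ is) with does (i ∈? x)
  ... | true  = ≡.cong (f (suc i) List.∷_) (select-suc b x f is)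
  ... | false = select-suc b x f is

  select-tabulate : ∀ b (x : Subset n) (f : Vector Carrier (suc n)) →
                    map f (filter (_∈? (b ∷ x)) (List.tabulate suc)) ≡ map (f ∘ suc) (filter (_∈? x) (allFin n))
  select-tabulate b x f = ≡.trans (≡.cong (map f ∘ filter (_∈? (b ∷ x))) (≡.sym (map-tabulate id suc)))
                                  (select-suc b x f (allFin _))

  ∏-∷ : ∀ b (x : Subset n) (f : Vector Carrier (suc n)) →
        ∏[ b ∷ x ] f ≈ (if b then f zero else 1#) * ∏[ x ] (f ∘ suc)
  ∏-∷ true  x f = *-congˡ (reflexive (≡.cong ∏ (select-tabulate true x f)))
  ∏-∷ false x f = trans (reflexive (≡.cong ∏ (select-tabulate false x f))) (sym (*-identityˡ _))

  factor : Carrier → Bool → Carrier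
  factor p b = if b then p else 1# - p

  weight-∷ : ∀ (p : Vector Carrier (suc n)) b x → weight p (b ∷ x) ≈ factor (p zero) b * weight (p ∘ suc) x
  weight-∷ p true  x = trans (*-cong (∏-∷ true x p) (∏-∷ false (∁ x) _))
    (solve 3 (λ c u v → c :* u :* (:1 :* v) := c :* (u :* v)) refl _ _ _)
  weight-∷ p false x = trans (*-cong (∏-∷ false x p) (∏-∷ true (∁ x) _))
    (solve 3 (λ c u v → :1 :* u :* (c :* v) := c :* (u :* v)) refl _ _ _)

  -- `μ` with the enumeration `subsets n` replaced by an arbitrary list, so that induction on the
  -- list is possible.
  total : Vector Carrier n → ∀ {u} {U : Pred (Subset n) u} → Decidable U → List (Subset n) → Carrier
  total p U? xs = ∑ (map (weight p) (filter U? xs))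

  total-++ : ∀ (p : Vector Carrier n) {u} {U : Pred (Subset n) u} (U? : Decidable U) xs ys →
             total p U? (xs ++ ys) ≈ total p U? xs + total p U? ys
  total-++ p U? List.[]       ys = sym (+-identityˡ _)
  total-++ p U? (x List.∷ xs) ys with does (U? x)
  ... | true  = trans (+-congˡ (total-++ p U? xs ys)) (sym (+-assoc _ _ _))
  ... | false = total-++ p U? xs ys

  total-∷ : ∀ (p : Vector Carrier (suc n)) {u} {U : Pred (Subset (suc n)) u} (U? : Decidable U) b xs →
            total p U? (map (b ∷_) xs) ≈ factor (p zero) b * total (p ∘ suc) (U? ∘ (b ∷_)) xs
  total-∷ p U? b List.[]       = sym (zeroʳ _)
  total-∷ p U? b (x List.∷ xs) with does (U? (b ∷ x))
  ... | true  = trans (+-cong (weight-∷ p b x) (total-∷ p U? b xs)) (sym (distribˡ _ _ _))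
  ... | false = total-∷ p U? b xs

  μ≈ν : ∀ (p : Vector Carrier n) {u} {U : Pred (Subset n) u} (U? : Decidable U) → μ p U? ≈ ν p (does ∘ U?)
  μ≈ν {zero} p U? with does (U? [])
  ... | true  = trans (+-identityʳ _) (*-identityˡ 1#)
  ... | false = refl
  μ≈ν {suc n} p U? = trans (total-++ p U? (map (inside ∷_) (subsets n)) _)
    (+-cong (trans (total-∷ p U? inside (subsets n)) (*-congˡ (μ≈ν (p ∘ suc) _)))
            (trans (total-∷ p U? outside (subsets n)) (*-congˡ (μ≈ν (p ∘ suc) _))))

witness : ∀ {a} {A : Set a} (A? : Dec A) → does A? ≡ true → A
witness (yes a) _ = a

-- Lowering a first probability above one half.

module Capping {c ℓ₁ ℓ₂} (R : RealNumbers c ℓ₁ ℓ₂) where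
  open OrderedField R
  open MixedSections R
  open Regions R
  open Measures R
  open Extremal R
  open ProductMeasure R using (IsProbabilityVector; w)

  ½+½≈1 : ½ + ½ ≈ 1#
  ½+½≈1 = trans (solve 1 (λ h → h :+ h := (:1 :+ :1) :* h) refl ½) (*-inverse 0<2)

  ≈1-⇒≈½ : ∀ {h} → h ≈ 1# - h → h ≈ ½
  ≈1-⇒≈½ {h} e = *-cancelˡ 0<2 (trans (solve 1 (λ h → (:1 :+ :1) :* h := h :+ h) refl h)
    (trans (+-congˡ e) (trans (solve 1 (λ h → h :+ (:1 :- h) := :1) refl h) (sym (*-inverse 0<2)))))

  -- h stands for min (p zero) ½.
  record Cap {m} (p : Vector Carrier (suc m)) : Set (c ⊔ ℓ₂) where
    field
      h      : Carrier
      0<h    : 0# < h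
      h≤1-h  : h ≤ 1# - h
      h≤head : h ≤ p zero
      tail≤h : ∀ ℓ → p (suc ℓ) ≤ h

    capped : Vector Carrier (suc m)
    capped = h ∷ᵛ p ∘ suc

  cap : ∀ {m} {p : Vector Carrier (suc m)} → 0# < p zero → (∀ ℓ → p ℓ ≤ p zero) → (∀ ℓ → p (suc ℓ) ≤ ½) → ¬ ¬ Cap p
  cap {p = p} 0<p p≤head tail≤½ = ≤-cases (p zero) ½ >>= λ where
      (inj₁ p≤½) → return record
        { h = p zero ; 0<h = 0<p ; h≤head = ≤-reflexive refl ; tail≤h = p≤head ∘ suc
        ; h≤1-h = ≤-trans p≤½ (≤-respˡ-≈ 1-½≈½ (1-‿anti p≤½)) }
      (inj₂ ½<p) → return record
        { h = ½ ; 0<h = 0<inverse 0<2 ; h≤head = <⇒≤ ½<p ; tail≤h = tail≤½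
        ; h≤1-h = ≤-reflexive (sym 1-½≈½) }
    where
    1-½≈½ : 1# - ½ ≈ ½
    1-½≈½ = trans (+-congʳ (sym ½+½≈1)) (solve 1 (λ h → h :+ h :- h := h) refl ½)

  module _ {m} {p : Vector Carrier (suc m)} (C : Cap p) (f : Family (suc m)) where
    open Cap C

    -- Compares `ν p f / p zero` with `ν capped f / h` after cross-multiplication. The upper
    -- sections contribute equally, so the whole difference comes from `f ⁻`.
    capping-loss : p zero * ν capped f - ν p f * h ≈ (p zero - h) * ν (p ∘ suc) (f ⁻)
    capping-loss = solve 4 (λ p h a b → p :* (h :* a :+ (:1 :- h) :* b) :- (p :* a :+ (:1 :- p) :* b) :* h
                                          := (p :- h) :* b) refl (p zero) h (ν (p ∘ suc) (f ⁺)) (ν (p ∘ suc) (f ⁻))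

    ν*h≤ : IsProbabilityVector p → ν p f * h ≤ p zero * ν capped f
    ν*h≤ pv = ≤-from capping-loss (0≤* (≤⇒0≤- h≤head) (0≤ν (tail pv) {f ⁻}))

  module Capped {m} {p₁ p₂ : Vector Carrier (suc m)} (pv₁ : IsProbabilityVector p₁) (pv₂ : IsProbabilityVector p₂)
                (C₁ : Cap p₁) (C₂ : Cap p₂) {f g : Family (suc m)} (cross : Cross f g) where
    private
      module C₁ = Cap C₁
      module C₂ = Cap C₂

    h₁ h₂ a b : Carrier
    h₁ = C₁.h
    h₂ = C₂.h
    a  = ν C₁.capped f
    b  = ν C₂.capped g

    open Bounded h₁ h₂ C₁.0<h C₂.0<h C₁.h≤1-h C₂.h≤1-h
    open Step h₁ h₂ C₁.0<h C₂.0<h C₁.h≤1-h C₂.h≤1-h using (0<P; 0<q₁; 0<q₂; ratio; α; β; κ; κ≤1; α≤1; β≤1; 0<α; 0<β)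

    admissible : Admissible C₁.capped C₂.capped
    admissible = record
      { probability₁ = λ { zero → C₁.0<h , 0<-⇒< 0<q₁ ; (suc ℓ) → pv₁ (suc ℓ) }
      ; probability₂ = λ { zero → C₂.0<h , 0<-⇒< 0<q₂ ; (suc ℓ) → pv₂ (suc ℓ) }
      ; bounded₁ = λ { zero → ≤-reflexive refl ; (suc ℓ) → C₁.tail≤h ℓ }
      ; bounded₂ = λ { zero → ≤-reflexive refl ; (suc ℓ) → C₂.tail≤h ℓ } }

    open Admissible admissible

    F : Feasible h₁ h₂ a b
    F = feasible admissible cross

    open Feasible F

    0<heads : 0# < p₁ zero * p₂ zero
    0<heads = *-pos (proj₁ (pv₁ zero)) (proj₁ (pv₂ zero))

    regroup : ∀ p q u v → p * u * (q * v) ≈ p * q * (u * v)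
    regroup = solve 4 (λ p q u v → p :* u :* (q :* v) := p :* q :* (u :* v)) refl

    capped≤ : p₁ zero * a * (p₂ zero * b) ≤ p₁ zero * p₂ zero * (h₁ * h₂)
    capped≤ = ≤-respˡ-≈ (sym (regroup _ _ _ _))
      (*-mono-≤ (<⇒≤ 0<heads) (0≤* 0≤a 0≤b) (≤-reflexive refl) product≤)

    0≤νf*h : 0# ≤ ν p₁ f * h₁
    0≤νf*h = 0≤* (0≤ν pv₁ {f}) (<⇒≤ C₁.0<h)

    0≤νg*h : 0# ≤ ν p₂ g * h₂
    0≤νg*h = 0≤* (0≤ν pv₂ {g}) (<⇒≤ C₂.0<h)

    -- With the factor `h₁ * h₂` inserted, the two capping comparisons and the capped bound
    -- `a * b ≤ h₁ * h₂` chain together, and the factor cancels.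
    bound : ν p₁ f * ν p₂ g ≤ p₁ zero * p₂ zero
    bound = *-cancelˡ-≤ 0<P (≤-respˡ-≈
      (solve 4 (λ u h v k → u :* h :* (v :* k) := h :* k :* (u :* v)) refl (ν p₁ f) h₁ (ν p₂ g) h₂)
      (≤-respʳ-≈ (*-comm _ _) (≤-trans (*-mono-≤ 0≤νf*h 0≤νg*h (ν*h≤ C₁ f pv₁) (ν*h≤ C₂ g pv₂)) capped≤)))

    module Equality (e : ν p₁ f * ν p₂ g ≈ p₁ zero * p₂ zero) where
      uncapped≈ : ν p₁ f * h₁ * (ν p₂ g * h₂) ≈ p₁ zero * p₂ zero * (h₁ * h₂)
      uncapped≈ = trans (solve 4 (λ u h v k → u :* h :* (v :* k) := u :* v :* (h :* k)) refl (ν p₁ f) h₁ (ν p₂ g) h₂)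
                        (*-congʳ e)

      -- Equality in the theorem leaves no room in that chain, so neither capping comparison is
      -- strict.
      no-loss : ν p₁ f * h₁ ≈ p₁ zero * a × ν p₂ g * h₂ ≈ p₂ zero * b
      no-loss = *-mono-equality 0≤νf*h 0≤νg*h (ν*h≤ C₁ f pv₁) (ν*h≤ C₂ g pv₂)
        (<-respʳ-≈ (sym uncapped≈) (*-pos 0<heads 0<P)) (≤-respʳ-≈ (sym uncapped≈) capped≤)

      loss₁ : (p₁ zero - h₁) * ν (p₁ ∘ suc) (f ⁻) ≈ 0#
      loss₁ = trans (sym (capping-loss C₁ f)) (≈⇒-‿≈0 (sym (proj₁ no-loss)))

      loss₂ : (p₂ zero - h₂) * ν (p₂ ∘ suc) (g ⁻) ≈ 0#
      loss₂ = trans (sym (capping-loss C₂ g)) (≈⇒-‿≈0 (sym (proj₂ no-loss)))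

      ab≈P : a * b ≈ h₁ * h₂
      ab≈P = *-cancelˡ 0<heads (trans (sym (regroup _ _ _ _))
        (trans (*-cong (sym (proj₁ no-loss)) (sym (proj₂ no-loss))) uncapped≈))

      Winner : Set ℓ₁
      Winner = ∃[ ℓ ] (w p₁ p₂ ℓ × f ≗ star ℓ × g ≗ star ℓ)

      -- For a star at a later coordinate, the section without the first coordinate is again a star
      -- and has positive measure. Vanishing loss then forces each cap to equal the original first
      -- probability.
      uncap : Dictator C₁.capped C₂.capped f g → Winner
      uncap (zero  , _ , f≗ , g≗) = zero , (refl , refl) , f≗ , g≗
      uncap (suc k , (p₁k≈ , p₂k≈) , f≗ , g≗) = suc k , (trans p₁k≈ h₁≈ , trans p₂k≈ h₂≈) , f≗ , g≗
        where
        head≈ : ∀ {p : Vector Carrier (suc m)} {h j} → IsProbabilityVector p → j ≗ star (suc k) →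
                (p zero - h) * ν (p ∘ suc) (j ⁻) ≈ 0# → h ≈ p zero
        head≈ {p} pv j≗ loss = sym (-‿≈0⇒≈ (*≈0⇒≈0
          (<-respʳ-≈ (sym (trans (ν-cong (p ∘ suc) (λ x → j≗ (outside ∷ x))) (ν-star (p ∘ suc) k))) (proj₁ (pv (suc k))))
          (trans (*-comm _ _) loss)))

        h₁≈ : h₁ ≈ p₁ zero
        h₁≈ = head≈ pv₁ f≗ loss₁

        h₂≈ : h₂ ≈ p₂ zero
        h₂≈ = head≈ pv₂ g≗ loss₂

      -- If the cap is active on one side, that family lies in the star of zero; both families have
      -- capped measure ½, which forces the first to be the whole star and then the second too.
      head-star : ∀ {p q : Vector Carrier (suc m)} → IsProbabilityVector p → IsProbabilityVector q →
                  {j k : Family (suc m)} → Cross j k → ∀ {h l} → h + h ≈ 1# → l + l ≈ 1# →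
                  ν (h ∷ᵛ p ∘ suc) j + ν (h ∷ᵛ p ∘ suc) j ≈ 1# → ν (l ∷ᵛ q ∘ suc) k + ν (l ∷ᵛ q ∘ suc) k ≈ 1# →
                  h < p zero → (p zero - h) * ν (p ∘ suc) (j ⁻) ≈ 0# → j ≗ star zero × k ≗ star zero
      head-star {p} {q} pv qv {j} {k} cr 2h≈1 2l≈1 2a≈1 2b≈1 h<p loss =
          glue {f = j} {star zero} j⁺true (ν≈0⇒false (tail pv) {j ⁻} j⁻≈0)
        , glue {f = k} {star zero} k⁺true k⁻false
        where
        j⁻≈0 : ν (p ∘ suc) (j ⁻) ≈ 0#
        j⁻≈0 = *≈0⇒≈0 (<⇒0<- h<p) loss

        j⁺true : j ⁺ ≗ const true
        j⁺true = ν≈1⇒true (tail pv) {j ⁺} (+≈1∧≈0⇒≈1 (trans (+-comm _ _) (mix-halves 2h≈1 2a≈1 refl)) j⁻≈0)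

        k⁻false : k ⁻ ≗ const false
        -- The full section `j ⁺` contains the empty set, which no member of `k ⁻` can meet.
        k⁻false x = Bool.¬-not λ kx → let _ , ℓ∈ = Cross-⁺⁻ {f = j} {k} cr (j⁺true ⊥) kx in ∉⊥ (p∩q⊆p ⊥ x ℓ∈)

        k⁺true : k ⁺ ≗ const true
        k⁺true = ν≈1⇒true (tail qv) {k ⁺} (+≈1∧≈0⇒≈1 (trans (+-comm _ _) (mix-halves 2l≈1 2b≈1 refl))
          (trans (ν-cong (q ∘ suc) k⁻false) (ν-const (q ∘ suc) false)))

      module Halves (κ≈1 : κ ≈ 1#) where
        -- Two ratios that are at most 1 and have product 1 both equal 1; this makes both caps one
        -- half.
        ratio≈1⇒ : ∀ {h q} {x y : Carrier} → q * x ≈ h → x ≤ 1# → y ≤ 1# → 0# ≤ x → x * y ≈ 1# → h ≈ q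
        ratio≈1⇒ {h} {q} {x} {y} qx≈h x≤1 y≤1 0≤x xy≈1 = trans (sym qx≈h) (trans (*-congˡ x≈1) (*-identityʳ q))
          where
          x≈1 : x ≈ 1#
          x≈1 = ≤-antisym x≤1 (≤-from (trans (solve 2 (λ x y → x :- :1 := x :* (:1 :- y) :+ (x :* y :- :1)) refl x y)
                  (+-zeroʳ (≈⇒-‿≈0 xy≈1))) (0≤* 0≤x (≤⇒0≤- y≤1)))

        h₁≈1-h₁ : h₁ ≈ 1# - h₁
        h₁≈1-h₁ = ratio≈1⇒ (ratio 0<q₁) α≤1 β≤1 (<⇒≤ 0<α) κ≈1

        h₂≈1-h₂ : h₂ ≈ 1# - h₂
        h₂≈1-h₂ = ratio≈1⇒ (ratio 0<q₂) β≤1 α≤1 (<⇒≤ 0<β) (trans (*-comm _ _) κ≈1)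

        open Half h₁≈1-h₁ h₂≈1-h₂

        2h₁≈1 : h₁ + h₁ ≈ 1#
        2h₁≈1 = p₁+p₁≈1

        2h₂≈1 : h₂ + h₂ ≈ 1#
        2h₂≈1 = trans (+-congˡ h₂≈1-h₂) (solve 1 (λ h → h :+ (:1 :- h) := :1) refl h₂)

        4ab≈1 : (1# + 1#) * (1# + 1#) * (a * b) ≈ 1#
        4ab≈1 = trans (*-congˡ ab≈P) (trans
          (solve 2 (λ h k → (:1 :+ :1) :* (:1 :+ :1) :* (h :* k) := (h :+ h) :* (k :+ k)) refl h₁ h₂)
          (trans (*-cong 2h₁≈1 2h₂≈1) (*-identityˡ 1#)))

        -- The equality case of the inequality of arithmetic and geometric means: `4 a b = 1` while
        -- `a + b ≤ 1`.
        a≈b : a ≈ b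
        a≈b = -‿≈0⇒≈ (x²≈0⇒x≈0 (≤-antisym
          (≤-from (trans
            (solve 2 (λ a b → :0 :- (a :- b) :* (a :- b) := (:1 :- (a :+ b)) :* (:1 :+ (a :+ b))
                                 :+ ((:1 :+ :1) :* (:1 :+ :1) :* (a :* b) :- :1)) refl a b)
            (+-zeroʳ (≈⇒-‿≈0 4ab≈1)))
            (0≤* (≤⇒0≤- (sum≤1 F)) (0≤+ 0≤1 (0≤+ 0≤a 0≤b))))
          (0≤x² (a - b))))

        2a≈1 : a + a ≈ 1#
        2a≈1 = -‿≈0⇒≈ (*≈0⇒≈0 (<-≤-trans 0<1 (≤-from (solve 1 (λ u → :1 :+ u :- :1 := u) refl (a + a)) (0≤+ 0≤a 0≤a)))
          (trans (solve 1 (λ a → (:1 :+ (a :+ a)) :* (a :+ a :- :1) := (:1 :+ :1) :* (:1 :+ :1) :* (a :* a) :- :1) refl a)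
                 (≈⇒-‿≈0 (trans (*-congˡ (*-congˡ a≈b)) 4ab≈1))))

        sum≈1 : a + b ≈ 1#
        sum≈1 = trans (+-congˡ (sym a≈b)) 2a≈1

        2b≈1 : b + b ≈ 1#
        2b≈1 = trans (+-congʳ (sym a≈b)) sum≈1

        winner : ¬ (p₁ zero ≈ ½ × p₂ zero ≈ ½ × HasAtLeast 3 (w p₁ p₂)) → ¬ ¬ Winner
        winner generic = ≤-split C₁.h≤head >>= λ where
            (inj₁ h₁<) → let f≗ , g≗ = head-star pv₁ pv₂ {f} {g} cross 2h₁≈1 2h₂≈1 2a≈1 2b≈1 h₁< loss₁
                         in return (zero , (refl , refl) , f≗ , g≗)
            (inj₂ h₁≈) → ≤-split C₂.h≤head >>= λ where
              (inj₁ h₂<) → let g≗ , f≗ = head-star pv₂ pv₁ {g} {f} (Cross-sym {f = f} {g} cross)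
                                           2h₂≈1 2h₁≈1 2b≈1 2a≈1 h₂< loss₂
                           in return (zero , (refl , refl) , f≗ , g≗)
              -- With both caps inactive, extreme coordinates lie in `w`, so three of them would
              -- contradict `generic`.
              (inj₂ h₂≈) → half-dictator admissible {f} {g} cross sum≈1 2a≈1
                (λ (i , ext) → generic (trans (sym h₁≈) (≈1-⇒≈½ h₁≈1-h₁) , trans (sym h₂≈) (≈1-⇒≈½ h₂≈1-h₂)
                                       , i , λ k → extreme⇒w h₁≈ h₂≈ _ (ext k))) >>= λ D → return (uncap D)
          where
          extreme⇒w : h₁ ≈ p₁ zero → h₂ ≈ p₂ zero → ∀ ℓ → Extreme C₁.capped C₂.capped ℓ → w p₁ p₂ ℓ
          extreme⇒w h₁≈ h₂≈ zero    _           = refl , refl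
          extreme⇒w h₁≈ h₂≈ (suc ℓ) (e₁ , e₂) = trans e₁ h₁≈ , trans e₂ h₂≈

      winner : ¬ (p₁ zero ≈ ½ × p₂ zero ≈ ½ × HasAtLeast 3 (w p₁ p₂)) → ¬ ¬ Winner
      winner generic = ≤-split κ≤1 >>= λ where
        (inj₁ κ<1) → dictator κ<1 admissible {f} {g} cross ab≈P >>= λ D → return (uncap D)
        (inj₂ κ≈1) → Halves.winner κ≈1 generic

-- Return to predicates, and the theorem.

module _ {n u} {U : Pred (Subset n) u} (U? : Decidable U) {ℓ : Fin n} where
  ≐Star⇒≗star : U ≐ Star ℓ → does ∘ U? ≗ star ℓ
  ≐Star⇒≗star (U⊆ , ⊆U) x = Bool.⇔→≡ {z = true} (mk⇔ ([]=⇒lookup ∘ U⊆ ∘ witness (U? x)) (dec-true (U? x) ∘ ⊆U ∘ lookup⇒[]= ℓ x))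

  ≗star⇒≐Star : does ∘ U? ≗ star ℓ → U ≐ Star ℓ
  ≗star⇒≐Star U≗ = (λ {x} Ux → lookup⇒[]= ℓ x (≡.trans (≡.sym (U≗ x)) (dec-true (U? x) Ux)))
                 , (λ {x} ℓ∈x → witness (U? x) (≡.trans (U≗ x) ([]=⇒lookup ℓ∈x)))

theorem2 : ∀ {c ℓ₁ ℓ₂ u₁ u₂} (R : RealNumbers c ℓ₁ ℓ₂) →
    let open RealNumbers R
        open ProductMeasure R
    in (m : ℕ) → let n = suc m in
       (p₁ p₂ : Vector Carrier n) →
       IsProbabilityVector p₁ → IsProbabilityVector p₂ →
       (p₁ zero) IsMaxOf p₁ → (p₂ zero) IsMaxOf p₂ →
       ((ℓ : Fin m) → p₁ (suc ℓ) ≤ ½ × p₂ (suc ℓ) ≤ ½) →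
       (U₁ : Pred (Subset n) u₁) (U₁? : Decidable U₁) →
       (U₂ : Pred (Subset n) u₂) (U₂? : Decidable U₂) →
       CrossIntersecting U₁ U₂ →
       (μ p₁ U₁? * μ p₂ U₂? ≤ p₁ zero * p₂ zero) ×
       (¬ (p₁ zero ≈ ½ × p₂ zero ≈ ½ × HasAtLeast 3 (w p₁ p₂)) →
        (μ p₁ U₁? * μ p₂ U₂? ≈ p₁ zero * p₂ zero) ⇔
        (∃[ ℓ ] (w p₁ p₂ ℓ × U₁ ≐ Star ℓ × U₂ ≐ Star ℓ)))
theorem2 R m p₁ p₂ pv₁ pv₂ (_ , p₁≤head) (_ , p₂≤head) tail≤½ U₁ U₁? U₂ U₂? cross =
    ≤-respˡ-≈ (sym μμ≈νν) (caps >>= λ (C₁ , C₂) → Capped.bound pv₁ pv₂ C₁ C₂ {f} {g} cross′)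
  , λ generic → mk⇔ (only-stars generic) stars
  where
  open OrderedField R
  open Measures R
  open Bridge R
  open Capping R
  open ProductMeasure R

  f g : Family (suc m)
  f = does ∘ U₁?
  g = does ∘ U₂?

  μμ≈νν : μ p₁ U₁? * μ p₂ U₂? ≈ ν p₁ f * ν p₂ g
  μμ≈νν = *-cong (μ≈ν p₁ U₁?) (μ≈ν p₂ U₂?)

  cross′ : Cross f g
  cross′ {x} {y} fx gy = cross (witness (U₁? x) fx) (witness (U₂? y) gy)

  caps : ¬ ¬ (Cap p₁ × Cap p₂)
  caps = cap (proj₁ (pv₁ zero)) p₁≤head (proj₁ ∘ tail≤½) >>= λ C₁ →
         cap (proj₁ (pv₂ zero)) p₂≤head (proj₂ ∘ tail≤½) >>= λ C₂ → return (C₁ , C₂)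

  stars : ∃[ ℓ ] (w p₁ p₂ ℓ × U₁ ≐ Star ℓ × U₂ ≐ Star ℓ) → μ p₁ U₁? * μ p₂ U₂? ≈ p₁ zero * p₂ zero
  stars (ℓ , (p₁ℓ≈ , p₂ℓ≈) , U₁≐ , U₂≐) = trans μμ≈νν (*-cong
    (trans (ν-cong p₁ (≐Star⇒≗star U₁? U₁≐)) (trans (ν-star p₁ ℓ) p₁ℓ≈))
    (trans (ν-cong p₂ (≐Star⇒≗star U₂? U₂≐)) (trans (ν-star p₂ ℓ) p₂ℓ≈)))

  only-stars : ¬ (p₁ zero ≈ ½ × p₂ zero ≈ ½ × HasAtLeast 3 (w p₁ p₂)) →
               μ p₁ U₁? * μ p₂ U₂? ≈ p₁ zero * p₂ zero →
               ∃[ ℓ ] (w p₁ p₂ ℓ × U₁ ≐ Star ℓ × U₂ ≐ Star ℓ)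
  -- A winning coordinate is known only under double negation. A search for a singleton in `U₁`
  -- yields a definite `ℓ`: the star of `k` contains `⁅ ℓ ⁆` only if `k` is `ℓ`. At this `ℓ` the
  -- remaining claims are stable.
  only-stars generic e = found (any? (U₁? ∘ ⁅_⁆))
    where
    Winner : Set _
    Winner = ∃[ ℓ ] (w p₁ p₂ ℓ × f ≗ star ℓ × g ≗ star ℓ)

    winner : ¬ ¬ Winner
    winner = caps >>= λ (C₁ , C₂) →
      Capped.Equality.winner pv₁ pv₂ C₁ C₂ {f} {g} cross′ (trans (sym μμ≈νν) e) generic

    found : Dec (∃[ ℓ ] U₁ ⁅ ℓ ⁆) → ∃[ ℓ ] (w p₁ p₂ ℓ × U₁ ≐ Star ℓ × U₂ ≐ Star ℓ)
    found (no none) = contradiction (λ (ℓ , _ , f≗ , _) → none (ℓ , proj₂ (≗star⇒≐Star U₁? f≗) (x∈⁅x⁆ ℓ))) winner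
    found (yes (ℓ , Uℓ)) =
        ℓ
      , ( ≈-stable (winner >>= λ W → return (proj₁ (proj₁ (at-ℓ W))))
        , ≈-stable (winner >>= λ W → return (proj₂ (proj₁ (at-ℓ W)))))
      , ≗star⇒≐Star U₁? (λ x → decidable-stable (f x Bool.≟ star ℓ x) (winner >>= λ W → return (proj₁ (proj₂ (at-ℓ W)) x)))
      , ≗star⇒≐Star U₂? (λ x → decidable-stable (g x Bool.≟ star ℓ x) (winner >>= λ W → return (proj₂ (proj₂ (at-ℓ W)) x)))
      where
      at-ℓ : Winner → w p₁ p₂ ℓ × f ≗ star ℓ × g ≗ star ℓ
      at-ℓ (k , W@(_ , f≗ , _)) = ≡.subst (λ i → w p₁ p₂ i × f ≗ star i × g ≗ star i)
        (x∈⁅y⁆⇒x≡y ℓ (proj₁ (≗star⇒≐Star U₁? f≗) Uℓ)) W
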